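{- Let $S$ be an additively reduced and additively atomic semidomain. (A) The following statements are equivalent: (1) $\mathcal{A}_{+}(S) = S^{\times}$; (2) every $f \in S[x^{\pm 1}]$ with $|\mathrm{supp}(f)| > 1$ can be expressed as the sum of at most two multiplicative irreducibles of $S[x^{\pm 1}]$; (3) there exists a positive integer $k$ such that every $f \in S[x^{\pm 1}]$ with $|\mathrm{supp}(f)| > 1$ can be expressed as the sum of at most $k$ multiplicative irreducibles of $S[x^{\pm 1}]$. (B) Moreover, suppose that any of the statements in (A) holds, and let $f \in S[x^{\pm 1}]$ with $|\mathrm{supp}(f)| > 1$ be such that $f$ does not have either of the following forms (with distinct integer exponents): (a) $f = ax^{k_0} + bx^{k_1}$ with $a, b \in S\setminus\{0\}$, where either $a \in S^{\times}$ or $b \in S^{\times}$; (b) $f = ax^{k_0} + bx^{k_1} + cx^{k_2}$, where $a, b, c \in S^{\times}$. Then $f$ is the sum of exactly two multiplicative irreducibles of $S[x^{\pm 1}]$, i.e., $f = g + h$ for some multiplicative irreducibles $g, h \in S[x^{\pm 1}]$.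
   Context: A semidomain is a subsemiring of an integral domain, i.e., a subset $S$ of an integral domain containing $0$ and $1$ and closed under addition and multiplication. $S^{\times}$ denotes the group of units of the multiplicative monoid $S^* = S\setminus\{0\}$ (elements having a multiplicative inverse in $S$). $\mathcal{A}_{+}(S)$ is the set of atoms of the additive monoid $(S,+)$: elements $a$ that are not additively invertible in $S$ and such that $a = b + c$ with $b, c \in S$ implies that $b$ or $c$ is additively invertible in $S$. $S$ is additively reduced if $0$ is the only invertible element of $(S,+)$. $S$ is additively atomic if every non-invertible element of $(S,+)$ is a sum of finitely many atoms of $(S,+)$. $S[x^{\pm 1}]$ is the semidomain of Laurent polynomials with coefficients in $S$; $\mathrm{supp}(f)$ is the set of exponents of $f$ with nonzero coefficient. A multiplicative irreducible of a semidomain $T$ is a nonzero non-unit $a \in T$ such that $a = bc$ with $b, c \in T$ implies $b \in T^{\times}$ or $c \in T^{\times}$. -}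

module Defs where

open import Algebra.Bundles using (RawMonoid; RawSemiring; CommutativeSemiring; CommutativeRing)
import Algebra.Definitions
import Algebra.Definitions.RawMonoid
import Algebra.Definitions.RawSemiring
open import Data.Fin.Base using (Fin; toℕ)
open import Data.Integer.Base as ℤ using (ℤ; ∣_∣; _⊖_; 0ℤ)
import Data.Integer.Properties as ℤₚ
open import Data.Nat.Base as ℕ using (ℕ; zero; suc)
import Data.Nat.Properties as ℕₚ
open import Data.Product.Base using (Σ; Σ-syntax; ∃; ∃-syntax; _×_; _,_; proj₁; proj₂)
open import Data.Sum.Base using (_⊎_)
open import Data.Vec.Functional using (Vector)
open import Function.Definitions using (Injective)
open import Level using (Level; _⊔_) renaming (suc to lsuc)
open import Relation.Binary.Core using (Rel)
open import Relation.Binary.Definitions using (_Respects_)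
open import Relation.Binary.PropositionalEquality using (_≡_; _≢_; refl; cong; subst)
open import Relation.Nullary using (¬_; yes; no; contradiction)
open import Relation.Unary using (Pred; _∈_)

private
  variable
    a c ℓ p : Level

------------------------------------------------------------------------
-- Semidomains

record IntegralDomain (c ℓ : Level) : Set (lsuc (c ⊔ ℓ)) where
  field
    commutativeRing : CommutativeRing c ℓ

  open CommutativeRing commutativeRing public

  field
    0≉1           : ¬ (0# ≈ 1#)
    noZeroDivisor : ∀ x y → x * y ≈ 0# → x ≈ 0# ⊎ y ≈ 0#

record Semidomain (c ℓ p : Level) : Set (lsuc (c ⊔ ℓ ⊔ p)) where
  field
    integralDomain : IntegralDomain c ℓ

  private module R = IntegralDomain integralDomain

  -- Being a subset of a setoid includes being closed under its equality.
  field
    S      : Pred R.Carrier p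
    S-resp : S Respects R._≈_
    0∈S    : R.0# ∈ S
    1∈S    : R.1# ∈ S
    +∈S    : ∀ {x y} → x ∈ S → y ∈ S → x R.+ y ∈ S
    *∈S    : ∀ {x y} → x ∈ S → y ∈ S → x R.* y ∈ S

  commutativeSemiring : CommutativeSemiring (c ⊔ p) ℓ
  commutativeSemiring = record
    { Carrier = ∃ S
    ; _≈_ = λ x y → proj₁ x R.≈ proj₁ y
    ; _+_ = λ (x , x∈S) (y , y∈S) → x R.+ y , +∈S x∈S y∈S
    ; _*_ = λ (x , x∈S) (y , y∈S) → x R.* y , *∈S x∈S y∈S
    ; 0#  = R.0# , 0∈S
    ; 1#  = R.1# , 1∈S
    ; isCommutativeSemiring = record
      { isSemiring = record
        { isSemiringWithoutAnnihilatingZero = record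
          { +-isCommutativeMonoid = record
            { isMonoid = record
              { isSemigroup = record
                { isMagma = record
                  { isEquivalence = record { refl = R.refl ; sym = R.sym ; trans = R.trans }
                  ; ∙-cong = R.+-cong
                  }
                ; assoc = λ x y z → R.+-assoc (proj₁ x) (proj₁ y) (proj₁ z)
                }
              ; identity = (λ x → R.+-identityˡ (proj₁ x)) , (λ x → R.+-identityʳ (proj₁ x))
              }
            ; comm = λ x y → R.+-comm (proj₁ x) (proj₁ y)
            }
          ; *-cong = R.*-cong
          ; *-assoc = λ x y z → R.*-assoc (proj₁ x) (proj₁ y) (proj₁ z)
          ; *-identity = (λ x → R.*-identityˡ (proj₁ x)) , (λ x → R.*-identityʳ (proj₁ x))
          ; distrib = (λ x y z → R.distribˡ (proj₁ x) (proj₁ y) (proj₁ z))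
                    , (λ x y z → R.distribʳ (proj₁ x) (proj₁ y) (proj₁ z))
          }
        ; zero = (λ x → R.zeroˡ (proj₁ x)) , (λ x → R.zeroʳ (proj₁ x))
        }
      ; *-comm = λ x y → R.*-comm (proj₁ x) (proj₁ y)
      }
    }

  open CommutativeSemiring commutativeSemiring public
    hiding (refl; sym; trans)

------------------------------------------------------------------------
-- Invertible elements, atoms, irreducibles, sums

module _ (M : RawMonoid c ℓ) where
  open RawMonoid M
  open Algebra.Definitions _≈_ using (Invertible)
  open Algebra.Definitions.RawMonoid M using (sum)

  IsInvertible : Pred Carrier (c ⊔ ℓ)
  IsInvertible = Invertible ε _∙_

  IsAtom : Pred Carrier (c ⊔ ℓ)
  IsAtom a = ¬ IsInvertible a
           × (∀ b c → a ≈ b ∙ c → IsInvertible b ⊎ IsInvertible c)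

  IsSumOf : Pred Carrier p → ℕ → Pred Carrier (c ⊔ ℓ ⊔ p)
  IsSumOf P n a = Σ[ v ∈ Vector Carrier n ] (∀ i → v i ∈ P) × a ≈ sum v

  IsSumOfAtMost : Pred Carrier p → ℕ → Pred Carrier (c ⊔ ℓ ⊔ p)
  IsSumOfAtMost P k a = ∃[ n ] n ℕ.≤ k × IsSumOf P n a

module _ (A : RawSemiring c ℓ) where
  open RawSemiring A
  open Algebra.Definitions.RawSemiring A using (Irreducible)

  𝒜₊ : Pred Carrier (c ⊔ ℓ)
  𝒜₊ = IsAtom +-rawMonoid

  Units : Pred Carrier (c ⊔ ℓ)
  Units = IsInvertible *-rawMonoid

  AdditivelyReduced : Set (c ⊔ ℓ)
  AdditivelyReduced = ∀ a → IsInvertible +-rawMonoid a → a ≈ 0#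

  AdditivelyAtomic : Set (c ⊔ ℓ)
  AdditivelyAtomic = ∀ a → ¬ IsInvertible +-rawMonoid a →
                     ∃[ n ] IsSumOf +-rawMonoid 𝒜₊ n a

  -- The library's Irreducible writes "x is a unit" as x ∣ 1# and does not
  -- itself mention that the element is nonzero.
  MultIrreducible : Pred Carrier (c ⊔ ℓ)
  MultIrreducible a = a ≉ 0# × Irreducible a

-- The cardinality of P is greater than k: suc k distinct elements lie in P.
HasMoreThan : {A : Set a} → ℕ → Pred A p → Set (a ⊔ p)
HasMoreThan {A = A} k P =
  Σ[ v ∈ Vector A (suc k) ] Injective _≡_ _≡_ v × (∀ i → v i ∈ P)

------------------------------------------------------------------------
-- Laurent polynomials, as finitely supported functions ℤ → A

module LaurentPolynomial (A : CommutativeSemiring c ℓ) where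
  private module A = CommutativeSemiring A
  open Algebra.Definitions.RawMonoid A.+-rawMonoid using (sum)

  record Laurent : Set (c ⊔ ℓ) where
    field
      coeff    : ℤ → A.Carrier
      bound    : ℕ
      vanishes : ∀ n → bound ℕ.< ∣ n ∣ → coeff n A.≈ A.0#

  open Laurent public

  -- The bound is auxiliary data, ignored by the equality.
  infix 4 _≈ᴸ_
  _≈ᴸ_ : Rel Laurent ℓ
  f ≈ᴸ g = ∀ n → coeff f n A.≈ coeff g n

  supp : Laurent → Pred ℤ ℓ
  supp f n = ¬ (coeff f n A.≈ A.0#)

  monomialCoeff : A.Carrier → ℤ → ℤ → A.Carrier
  monomialCoeff a k n with n ℤₚ.≟ k
  ... | yes _ = a
  ... | no  _ = A.0#

  monomial : A.Carrier → ℤ → Laurent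
  monomial a k = record
    { coeff    = monomialCoeff a k
    ; bound    = ∣ k ∣
    ; vanishes = van
    }
    where
    van : ∀ n → ∣ k ∣ ℕ.< ∣ n ∣ → monomialCoeff a k n A.≈ A.0#
    van n k<n with n ℤₚ.≟ k
    ... | yes refl = contradiction k<n (ℕₚ.<-irrefl refl)
    ... | no  _    = A.refl

  infixl 6 _+ᴸ_
  _+ᴸ_ : Laurent → Laurent → Laurent
  f +ᴸ g = record
    { coeff    = λ n → coeff f n A.+ coeff g n
    ; bound    = bound f ℕ.+ bound g
    ; vanishes = λ n lt → A.trans
        (A.+-cong (vanishes f n (ℕₚ.≤-<-trans (ℕₚ.m≤m+n _ _) lt))
                  (vanishes g n (ℕₚ.≤-<-trans (ℕₚ.m≤n+m _ _) lt)))
        (A.+-identityˡ A.0#)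
    }

  -- The integers -N, …, N.
  window : (N : ℕ) → Vector ℤ (suc (N ℕ.+ N))
  window N i = toℕ i ⊖ N

  private
    sum-zero : ∀ {m} (v : Vector A.Carrier m) → (∀ i → v i A.≈ A.0#) → sum v A.≈ A.0#
    sum-zero {zero}  v v≈0 = A.refl
    sum-zero {suc m} v v≈0 = A.trans
      (A.+-cong (v≈0 Fin.zero) (sum-zero (λ i → v (Fin.suc i)) (λ i → v≈0 (Fin.suc i))))
      (A.+-identityˡ A.0#)

    split : ∀ n i → ∣ n ∣ ℕ.≤ ∣ i ∣ ℕ.+ ∣ n ℤ.- i ∣
    split n i = subst (λ m → ∣ m ∣ ℕ.≤ ∣ i ∣ ℕ.+ ∣ n ℤ.- i ∣) i+[n-i]≡n
                      (ℤₚ.∣i+j∣≤∣i∣+∣j∣ i (n ℤ.- i))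
      where
      open import Relation.Binary.PropositionalEquality using (module ≡-Reasoning)
      open ≡-Reasoning
      i+[n-i]≡n : i ℤ.+ (n ℤ.- i) ≡ n
      i+[n-i]≡n = begin
        i ℤ.+ (n ℤ.- i)         ≡⟨ ℤₚ.+-comm i (n ℤ.- i) ⟩
        n ℤ.- i ℤ.+ i           ≡⟨ ℤₚ.+-assoc n (ℤ.- i) i ⟩
        n ℤ.+ (ℤ.- i ℤ.+ i)     ≡⟨ cong (λ m → n ℤ.+ m) (ℤₚ.+-inverseˡ i) ⟩
        n ℤ.+ 0ℤ                ≡⟨ ℤₚ.+-identityʳ n ⟩
        n                       ∎

  -- Convolution: all i outside the window contribute zero to Σᵢ fᵢ gₙ₋ᵢ.
  infixl 7 _*ᴸ_
  _*ᴸ_ : Laurent → Laurent → Laurent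
  f *ᴸ g = record
    { coeff    = λ n → sum λ i → term n (window (bound f) i)
    ; bound    = bound f ℕ.+ bound g
    ; vanishes = λ n lt → sum-zero _ λ i → van n lt (window (bound f) i)
    }
    where
    term : ℤ → ℤ → A.Carrier
    term n i = coeff f i A.* coeff g (n ℤ.- i)

    van : ∀ n → bound f ℕ.+ bound g ℕ.< ∣ n ∣ → ∀ i → term n i A.≈ A.0#
    van n lt i with bound f ℕₚ.<? ∣ i ∣ | bound g ℕₚ.<? ∣ n ℤ.- i ∣
    ... | yes p | _     = A.trans (A.*-congʳ (vanishes f i p)) (A.zeroˡ _)
    ... | no  _ | yes q = A.trans (A.*-congˡ (vanishes g _ q)) (A.zeroʳ _)
    ... | no ¬p | no ¬q = contradiction
      (ℕₚ.<-≤-trans lt (ℕₚ.≤-trans (split n i) (ℕₚ.+-mono-≤ (ℕₚ.≮⇒≥ ¬p) (ℕₚ.≮⇒≥ ¬q))))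
      (ℕₚ.<-irrefl refl)

  0ᴸ : Laurent
  0ᴸ = record { coeff = λ _ → A.0# ; bound = 0 ; vanishes = λ _ _ → A.refl }

  1ᴸ : Laurent
  1ᴸ = monomial A.1# 0ℤ

  rawSemiring : RawSemiring (c ⊔ ℓ) ℓ
  rawSemiring = record
    { Carrier = Laurent
    ; _≈_ = _≈ᴸ_
    ; _+_ = _+ᴸ_
    ; _*_ = _*ᴸ_
    ; 0#  = 0ᴸ
    ; 1#  = 1ᴸ
    }

------------------------------------------------------------------------
-- Sums of irreducibles in S[x^{±1}]

module LaurentSemidomain (D : Semidomain c ℓ p) where
  open Semidomain D using (Carrier; commutativeSemiring; _≉_; 0#)
    renaming (rawSemiring to S-rawSemiring)
  open LaurentPolynomial commutativeSemiring public

  Sˣ : Pred Carrier (c ⊔ ℓ ⊔ p)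
  Sˣ = Units S-rawSemiring

  IrreducibleLaurent : Pred Laurent (c ⊔ ℓ ⊔ p)
  IrreducibleLaurent = MultIrreducible rawSemiring

  SumsOfAtMost : ℕ → Set (c ⊔ ℓ ⊔ p)
  SumsOfAtMost k = ∀ f → HasMoreThan 1 (supp f) →
    IsSumOfAtMost (RawSemiring.+-rawMonoid rawSemiring) IrreducibleLaurent k f

  BinomialWithUnit : Pred Laurent (c ⊔ ℓ ⊔ p)
  BinomialWithUnit f =
    ∃[ a ] ∃[ b ] ∃[ k₀ ] ∃[ k₁ ]
      a ≉ 0# × b ≉ 0# × (a ∈ Sˣ ⊎ b ∈ Sˣ) × k₀ ≢ k₁ ×
      f ≈ᴸ monomial a k₀ +ᴸ monomial b k₁

  UnitTrinomial : Pred Laurent (c ⊔ ℓ ⊔ p)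
  UnitTrinomial f =
    ∃[ a ] ∃[ b ] ∃[ c ] ∃[ k₀ ] ∃[ k₁ ] ∃[ k₂ ]
      a ∈ Sˣ × b ∈ Sˣ × c ∈ Sˣ × k₀ ≢ k₁ × k₀ ≢ k₂ × k₁ ≢ k₂ ×
      f ≈ᴸ monomial a k₀ +ᴸ monomial b k₁ +ᴸ monomial c k₂

{-# OPTIONS --safe #-}
module Submission where

-- Nothing cancels in S, so supp (xy) = supp x + supp y. If h = xy with x, y not monomials, then
-- min x + max y and max x + min y are inner exponents of h, symmetric about the midpoint of its
-- extreme exponents; if they coincide, the coefficient there is a sum of two nonzero elements, so
-- it is not an atom. Hence h is irreducible as soon as it has a unit coefficient and all its inner
-- exponents lie on one side of the midpoint, with at most a unit at the midpoint itself.
-- When atoms and units coincide, every nonunit splits as a unit plus a nonzero element, and f is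
-- cut into two such polynomials, depending on which extreme coefficients of f are units.
-- Conversely, if an atom a is not a unit, then a (x⁻ᵏ + ⋯ + xᵏ) is not a sum of k irreducibles.

open import Defs
open import Algebra.Bundles using (CommutativeSemiring; RawSemiring)
open import Axiom.ExcludedMiddle using (ExcludedMiddle)
open import Data.Empty using (⊥-elim)
open import Data.Fin.Base using (Fin; zero; suc; toℕ; fromℕ<; punchOut)
import Data.Fin.Properties as Fin
open import Data.Integer.Base as ℤ using (ℤ; +_; -[1+_]; 0ℤ; ∣_∣; _⊖_)
import Data.Integer.Properties as ℤ
open import Algebra.Properties.CommutativeSemigroup ℤ.+-commutativeSemigroup using (interchange)
open import Algebra.Properties.AbelianGroup ℤ.+-0-abelianGroup using ()
  renaming (∙-cancelˡ to +-cancelˡ; ∙-cancelʳ to +-cancelʳ; xyx⁻¹≈y to [i+j]-i≡j)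
open import Data.Nat.Base as ℕ using (ℕ; zero; suc; _<_; z≤n; s≤s)
import Data.Nat.Properties as ℕ
open import Data.Product.Base using (∃; ∃-syntax; _×_; _,_; proj₁; proj₂)
open import Data.Sum.Base using (_⊎_; inj₁; inj₂; [_,_]′)
open import Data.Vec.Functional using (Vector; removeAt)
open import Data.Vec.Functional.Properties using (removeAt-punchOut)
open import Function.Base using (_∘_; flip; id)
open import Function.Bundles using (_⇔_; mk⇔)
open import Level using (Level; _⊔_; Lift; lift; lower; 0ℓ)
open import Relation.Binary.Core using (Rel)
open import Relation.Binary.Definitions using (tri<; tri≈; tri>)
import Relation.Binary.Construct.Flip.EqAndOrd as Flip
open import Relation.Binary.Structures using (IsStrictTotalOrder)
open import Relation.Binary.PropositionalEquality as ≡ using (_≡_; _≢_)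
import Relation.Binary.Reasoning.Setoid as SetoidReasoning
open import Relation.Nullary using (¬_; Dec; yes; no)
open import Relation.Nullary.Decidable using (map′; decidable-stable)
open import Relation.Nullary.Negation using (contradiction)
open import Relation.Unary using (Pred; _∈_; _≐_)

-- Integer arithmetic and translation-invariant orders

window-injective : ∀ N {i j : Fin (suc (N ℕ.+ N))} → toℕ i ⊖ N ≡ toℕ j ⊖ N → i ≡ j
window-injective N {i} {j} eq = Fin.toℕ-injective (ℤ.+-injective (+-cancelʳ (ℤ.- (+ N)) _ _
  (≡.trans (ℤ.m-n≡m⊖n (toℕ i) N) (≡.trans eq (≡.sym (ℤ.m-n≡m⊖n (toℕ j) N))))))

window-surjective : ∀ N n → ∣ n ∣ ℕ.≤ N → ∃[ i ] toℕ {suc (N ℕ.+ N)} i ⊖ N ≡ n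
window-surjective N (+ k) k≤N = fromℕ< lt , (begin
  toℕ (fromℕ< lt) ⊖ N     ≡⟨ ≡.cong (_⊖ N) (Fin.toℕ-fromℕ< lt) ⟩
  (k ℕ.+ N) ⊖ N           ≡⟨ ℤ.⊖-≥ (ℕ.m≤n+m N k) ⟩
  + (k ℕ.+ N ℕ.∸ N)       ≡⟨ ≡.cong +_ (ℕ.m+n∸n≡m k N) ⟩
  + k                     ∎)
  where
  open ≡.≡-Reasoning
  lt : k ℕ.+ N ℕ.< suc (N ℕ.+ N)
  lt = s≤s (ℕ.+-monoˡ-≤ N k≤N)
window-surjective N -[1+ k ] k<N = fromℕ< lt , (begin
  toℕ (fromℕ< lt) ⊖ N         ≡⟨ ≡.cong (_⊖ N) (Fin.toℕ-fromℕ< lt) ⟩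
  (N ℕ.∸ suc k) ⊖ N           ≡⟨ ℤ.⊖-≤ (ℕ.m∸n≤m N (suc k)) ⟩
  ℤ.- + (N ℕ.∸ (N ℕ.∸ suc k)) ≡⟨ ≡.cong (λ m → ℤ.- + m) (ℕ.m∸[m∸n]≡n k<N) ⟩
  -[1+ k ]                    ∎)
  where
  open ≡.≡-Reasoning
  lt : N ℕ.∸ suc k ℕ.< suc (N ℕ.+ N)
  lt = s≤s (ℕ.≤-trans (ℕ.m∸n≤m N (suc k)) (ℕ.m≤m+n N N))

i+[n-i]≡n : ∀ i n → i ℤ.+ (n ℤ.- i) ≡ n
i+[n-i]≡n i n = ≡.trans (≡.sym (ℤ.+-assoc i n (ℤ.- i))) ([i+j]-i≡j i n)

n-[n-k]≡k : ∀ n k → n ℤ.- (n ℤ.- k) ≡ k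
n-[n-k]≡k n k = ≡.trans (≡.cong (ℤ._- (n ℤ.- k)) (≡.sym (≡.trans (ℤ.+-comm (n ℤ.- k) k) (i+[n-i]≡n k n))))
                        ([i+j]-i≡j (n ℤ.- k) k)

-- The order stays abstract so that every argument can also be read for the reversed order, which
-- amounts to substituting x⁻¹ for x.
record TranslationOrder : Set₁ where
  infix 4 _≺_ _≼_
  field
    _≺_                : Rel ℤ 0ℓ
    isStrictTotalOrder : IsStrictTotalOrder _≡_ _≺_
    +-monoʳ-≺          : ∀ i {j k} → j ≺ k → i ℤ.+ j ≺ i ℤ.+ k

  open IsStrictTotalOrder isStrictTotalOrder public using (compare) renaming (trans to ≺-trans)

  ≺-irrefl : ∀ {i} → ¬ i ≺ i
  ≺-irrefl = IsStrictTotalOrder.irrefl isStrictTotalOrder ≡.refl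

  ≺⇒≢ : ∀ {i j} → i ≺ j → i ≢ j
  ≺⇒≢ i≺j ≡.refl = ≺-irrefl i≺j

  _≼_ : Rel ℤ 0ℓ
  i ≼ j = i ≺ j ⊎ i ≡ j

  ≼-≺-trans : ∀ {i j k} → i ≼ j → j ≺ k → i ≺ k
  ≼-≺-trans (inj₁ i≺j)    j≺k = ≺-trans i≺j j≺k
  ≼-≺-trans (inj₂ ≡.refl) j≺k = j≺k

  ≺-≼-trans : ∀ {i j k} → i ≺ j → j ≼ k → i ≺ k
  ≺-≼-trans i≺j (inj₁ j≺k)    = ≺-trans i≺j j≺k
  ≺-≼-trans i≺j (inj₂ ≡.refl) = i≺j

  ≼-trans : ∀ {i j k} → i ≼ j → j ≼ k → i ≼ k
  ≼-trans (inj₁ i≺j)    j≼k = inj₁ (≺-≼-trans i≺j j≼k)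
  ≼-trans (inj₂ ≡.refl) j≼k = j≼k

  ≼-antisym : ∀ {i j} → i ≼ j → j ≼ i → i ≡ j
  ≼-antisym (inj₁ i≺j) j≼i = contradiction (≺-≼-trans i≺j j≼i) ≺-irrefl
  ≼-antisym (inj₂ i≡j) _   = i≡j

  ≼∧≢⇒≺ : ∀ {i j} → i ≼ j → i ≢ j → i ≺ j
  ≼∧≢⇒≺ (inj₁ i≺j) _   = i≺j
  ≼∧≢⇒≺ (inj₂ i≡j) i≢j = contradiction i≡j i≢j

  ≼-total : ∀ i j → i ≼ j ⊎ j ≺ i
  ≼-total i j with compare i j
  ... | tri< i≺j _ _ = inj₁ (inj₁ i≺j)
  ... | tri≈ _ i≡j _ = inj₁ (inj₂ i≡j)
  ... | tri> _ _ j≺i = inj₂ j≺i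

  ≼⇒⊁ : ∀ {i j} → i ≼ j → ¬ j ≺ i
  ≼⇒⊁ i≼j j≺i = ≺-irrefl (≼-≺-trans i≼j j≺i)

  inside⇒bounded : ∀ {m M n} → m ≺ M → (n ≢ m → n ≢ M → m ≺ n × n ≺ M) → m ≼ n × n ≼ M
  inside⇒bounded {m} {M} {n} m≺M inside with n ℤ.≟ m | n ℤ.≟ M
  ... | yes ≡.refl | _          = inj₂ ≡.refl , inj₁ m≺M
  ... | no _       | yes ≡.refl = inj₁ m≺M , inj₂ ≡.refl
  ... | no n≢m     | no n≢M     = let m≺n , n≺M = inside n≢m n≢M in inj₁ m≺n , inj₁ n≺M

  +-monoˡ-≺ : ∀ i {j k} → j ≺ k → j ℤ.+ i ≺ k ℤ.+ i
  +-monoˡ-≺ i {j} {k} j≺k = ≡.subst₂ _≺_ (ℤ.+-comm i j) (ℤ.+-comm i k) (+-monoʳ-≺ i j≺k)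

  +-mono-≼ : ∀ {i j k l} → i ≼ j → k ≼ l → i ℤ.+ k ≼ j ℤ.+ l
  +-mono-≼ {j = j} {k} i≼j k≼l = ≼-trans (left i≼j) (right k≼l)
    where
    left : ∀ {i} → i ≼ j → i ℤ.+ k ≼ j ℤ.+ k
    left (inj₁ i≺j)    = inj₁ (+-monoˡ-≺ k i≺j)
    left (inj₂ ≡.refl) = inj₂ ≡.refl
    right : ∀ {l} → k ≼ l → j ℤ.+ k ≼ j ℤ.+ l
    right (inj₁ k≺l)    = inj₁ (+-monoʳ-≺ j k≺l)
    right (inj₂ ≡.refl) = inj₂ ≡.refl

  -- If p and q differed, twice the smaller one would lie below s. A condition such as
  -- `¬ p ℤ.+ p ≺ s` puts p at or above s / 2 without dividing.
  p+q≡s⇒p≡q : ∀ {p q s} → p ℤ.+ q ≡ s → ¬ p ℤ.+ p ≺ s → ¬ q ℤ.+ q ≺ s → p ≡ q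
  p+q≡s⇒p≡q {p} {q} ≡.refl ¬2p≺s ¬2q≺s with compare p q
  ... | tri< p≺q _ _ = contradiction (+-monoʳ-≺ p p≺q) ¬2p≺s
  ... | tri≈ _ p≡q _ = p≡q
  ... | tri> _ _ q≺p = contradiction (+-monoˡ-≺ q q≺p) ¬2q≺s

usual : TranslationOrder
usual = record
  { _≺_ = ℤ._<_
  ; isStrictTotalOrder = ℤ.<-isStrictTotalOrder
  ; +-monoʳ-≺ = λ i → ℤ.+-monoʳ-< i
  }

reverse : TranslationOrder → TranslationOrder
reverse O = record
  { _≺_ = flip _≺_
  ; isStrictTotalOrder = Flip.isStrictTotalOrder isStrictTotalOrder
  ; +-monoʳ-≺ = λ i → +-monoʳ-≺ i
  }
  where open TranslationOrder O

module _ (O : TranslationOrder) where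
  open TranslationOrder O

  greatest-in-range : ∀ {q n} {P : Pred ℤ q} (P? : ∀ i → Dec (P i)) (v : Vector ℤ n) → (∃[ i ] P (v i)) →
                      ∃[ M ] P M × (∀ i → P (v i) → v i ≼ M)
  greatest-in-range {n = zero}  P? v (() , _)
  greatest-in-range {n = suc n} {P} P? v (i₀ , Pi₀) with Fin.any? (λ i → P? (v (suc i)))
  ... | no ¬∃ = v zero , at-zero i₀ Pi₀ , λ { zero _ → inj₂ ≡.refl ; (suc i) Pi → contradiction (i , Pi) ¬∃ }
    where
    at-zero : ∀ i → P (v i) → P (v zero)
    at-zero zero    Pi = Pi
    at-zero (suc i) Pi = contradiction (i , Pi) ¬∃
  ... | yes ∃tail with greatest-in-range P? (v ∘ suc) ∃tail | P? (v zero)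
  ...   | M , PM , max | no ¬P0 = M , PM , λ { zero P0 → contradiction P0 ¬P0 ; (suc i) → max i }
  ...   | M , PM , max | yes P0 with ≼-total (v zero) M
  ...     | inj₁ 0≼M = M , PM , λ { zero _ → 0≼M ; (suc i) → max i }
  ...     | inj₂ M≺0 = v zero , P0 , λ { zero _ → inj₂ ≡.refl ; (suc i) Pi → ≼-trans (max i Pi) (inj₁ M≺0) }

-- Laurent polynomials without cancellation

-- What the arguments below use of an additively reduced semidomain, detached from the ambient
-- integral domain.
record IsConicalDomain {c ℓ} (A : CommutativeSemiring c ℓ) : Set (c ⊔ ℓ) where
  open CommutativeSemiring A
  field
    1≉0           : 1# ≉ 0#
    conical       : ∀ a b → a + b ≈ 0# → a ≈ 0#
    noZeroDivisor : ∀ a b → a * b ≈ 0# → a ≈ 0# ⊎ b ≈ 0#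

module ConicalDomain {c ℓ} (A : CommutativeSemiring c ℓ) (em : ExcludedMiddle (c ⊔ ℓ))
  (isConicalDomain : IsConicalDomain A) where

  open CommutativeSemiring A hiding (zero)
  open IsConicalDomain isConicalDomain
  open LaurentPolynomial A
  open import Algebra.Properties.CommutativeMonoid.Sum +-commutativeMonoid
  open import Algebra.Definitions.RawSemiring (LaurentPolynomial.rawSemiring A)
    using (_∣_; Irreducible; mkIrred)
  private module ≈-Reasoning = SetoidReasoning setoid

  Unit : Pred Carrier (c ⊔ ℓ)
  Unit = Units (CommutativeSemiring.rawSemiring A)

  IrreducibleL : Pred Laurent (c ⊔ ℓ)
  IrreducibleL = MultIrreducible (LaurentPolynomial.rawSemiring A)

  dec : (P : Set ℓ) → Dec P
  dec P = map′ lower lift (em {Lift (c ⊔ ℓ) P})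

  _≈0? : ∀ a → Dec (a ≈ 0#)
  a ≈0? = dec (a ≈ 0#)

  ¬≉0⇒≈0 : ∀ {a} → ¬ a ≉ 0# → a ≈ 0#
  ¬≉0⇒≈0 = decidable-stable (_ ≈0?)

  ≉0-resp : ∀ {a b} → a ≈ b → a ≉ 0# → b ≉ 0#
  ≉0-resp a≈b a≉0 b≈0 = a≉0 (trans a≈b b≈0)

  coeff-cong : ∀ f {m n} → m ≡ n → coeff f m ≈ coeff f n
  coeff-cong f m≡n = reflexive (≡.cong (coeff f) m≡n)

  *-≉0 : ∀ {a b} → a ≉ 0# → b ≉ 0# → a * b ≉ 0#
  *-≉0 a≉0 b≉0 ab≈0 = [ a≉0 , b≉0 ]′ (noZeroDivisor _ _ ab≈0)

  *-≉0ˡ : ∀ {a b} → a * b ≉ 0# → a ≉ 0#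
  *-≉0ˡ ab≉0 a≈0 = ab≉0 (trans (*-congʳ a≈0) (zeroˡ _))

  *-≉0ʳ : ∀ {a b} → a * b ≉ 0# → b ≉ 0#
  *-≉0ʳ ab≉0 b≈0 = ab≉0 (trans (*-congˡ b≈0) (zeroʳ _))

  unit≉0 : ∀ {a} → Unit a → a ≉ 0#
  unit≉0 (b , ba≈1 , _) = *-≉0ʳ (≉0-resp (sym ba≈1) 1≉0)

  unit-resp : ∀ {a b} → a ≈ b → Unit a → Unit b
  unit-resp a≈b (u , ua≈1 , au≈1) = u , trans (*-congˡ (sym a≈b)) ua≈1 , trans (*-congʳ (sym a≈b)) au≈1

  unit-factorˡ : ∀ {a b} → Unit (a * b) → Unit a
  unit-factorˡ {a} {b} (u , _ , abu≈1) = b * u , trans (*-comm _ _) eq , eq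
    where eq = trans (sym (*-assoc a b u)) abu≈1

  unit-factorʳ : ∀ {a b} → Unit (a * b) → Unit b
  unit-factorʳ U = unit-factorˡ (unit-resp (*-comm _ _) U)

  -- Finite sums without cancellation

  sum≈0 : ∀ {n} (v : Vector Carrier n) → (∀ i → v i ≈ 0#) → sum v ≈ 0#
  sum≈0 {n} v v≈0 = trans (sum-cong-≋ v≈0) (sum-replicate-zero n)

  sum≉0⇒term≉0 : ∀ {n} (v : Vector Carrier n) → sum v ≉ 0# → ∃[ i ] v i ≉ 0#
  sum≉0⇒term≉0 {zero}  v Σ≉0 = contradiction refl Σ≉0
  sum≉0⇒term≉0 {suc n} v Σ≉0 with v zero ≈0?
  ... | no  v₀≉0 = zero , v₀≉0
  ... | yes v₀≈0 =
    let i , vᵢ≉0 = sum≉0⇒term≉0 (v ∘ suc) (≉0-resp (trans (+-congʳ v₀≈0) (+-identityˡ _)) Σ≉0)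
    in suc i , vᵢ≉0

  -- Isolating the term writes the sum as that term plus a remainder, and by `conical` a vanishing
  -- sum would make the term vanish.
  term≉0⇒sum≉0 : ∀ {n} (v : Vector Carrier n) i → v i ≉ 0# → sum v ≉ 0#
  term≉0⇒sum≉0 {suc n} v i vᵢ≉0 Σ≈0 = vᵢ≉0 (conical _ _ (trans (sym (sum-remove v)) Σ≈0))

  sum-two-terms : ∀ {n} (v : Vector Carrier n) {i j} → i ≢ j → v i ≉ 0# → v j ≉ 0# →
                  ∃[ a ] ∃[ b ] a ≉ 0# × b ≉ 0# × sum v ≈ a + b
  sum-two-terms {suc n} v {i} {j} i≢j vᵢ≉0 vⱼ≉0 =
    v i , sum (removeAt v i) , vᵢ≉0 ,
    term≉0⇒sum≉0 (removeAt v i) (punchOut i≢j)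
      (≉0-resp (reflexive (≡.sym (removeAt-punchOut v i≢j))) vⱼ≉0) ,
    sum-remove v

  sum-one-term : ∀ {n} (v : Vector Carrier n) i → (∀ j → j ≢ i → v j ≈ 0#) → sum v ≈ v i
  sum-one-term {suc n} v i v≈0 = begin
    sum v                      ≈⟨ sum-remove v ⟩
    v i + sum (removeAt v i)   ≈⟨ +-congˡ (sum≈0 _ (λ j → v≈0 _ (Fin.punchInᵢ≢i i j))) ⟩
    v i + 0#                   ≈⟨ +-identityʳ _ ⟩
    v i                        ∎
    where open ≈-Reasoning

  -- Coefficients and supports of products

  in-window : ∀ f {n} → coeff f n ≉ 0# → ∃[ i ] window (bound f) i ≡ n
  in-window f {n} fₙ≉0 = window-surjective (bound f) n (ℕ.≮⇒≥ (fₙ≉0 ∘ vanishes f n))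

  term : Laurent → Laurent → ℤ → ℤ → Carrier
  term f g n i = coeff f i * coeff g (n ℤ.- i)

  terms : ∀ f → Laurent → ℤ → Vector Carrier _
  terms f g n k = term f g n (window (bound f) k)

  *-supp⁻ : ∀ f g {n} → coeff (f *ᴸ g) n ≉ 0# → ∃[ i ] ∃[ j ] coeff f i ≉ 0# × coeff g j ≉ 0# × i ℤ.+ j ≡ n
  *-supp⁻ f g {n} ≉0 =
    let k , ≉0ₖ = sum≉0⇒term≉0 (terms f g n) ≉0
        i = window (bound f) k
    in i , n ℤ.- i , *-≉0ˡ ≉0ₖ , *-≉0ʳ ≉0ₖ , i+[n-i]≡n i n

  term≉0 : ∀ f g {i j n} → coeff f i ≉ 0# → coeff g j ≉ 0# → i ℤ.+ j ≡ n → term f g n i ≉ 0#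
  term≉0 f g {i} {j} fᵢ≉0 gⱼ≉0 ≡.refl = *-≉0 fᵢ≉0 (≉0-resp (coeff-cong g (≡.sym ([i+j]-i≡j i j))) gⱼ≉0)

  -- The term for i is nonzero because there are no zero divisors, and the other terms of the
  -- convolution cannot cancel it.
  *-supp⁺ : ∀ f g {i j} → coeff f i ≉ 0# → coeff g j ≉ 0# → coeff (f *ᴸ g) (i ℤ.+ j) ≉ 0#
  *-supp⁺ f g {i} {j} fᵢ≉0 gⱼ≉0 with in-window f fᵢ≉0
  ... | k , ≡.refl = term≉0⇒sum≉0 (terms f g (window (bound f) k ℤ.+ j)) k (term≉0 f g fᵢ≉0 gⱼ≉0 ≡.refl)

  -- Distinct i and i′ contribute separate nonzero terms to one coefficient. Such a coefficient
  -- cannot be a unit once units are indecomposable.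
  *-two-terms : ∀ f g {i j i′ j′} → coeff f i ≉ 0# → coeff g j ≉ 0# → coeff f i′ ≉ 0# → coeff g j′ ≉ 0# →
                i ≢ i′ → i ℤ.+ j ≡ i′ ℤ.+ j′ →
                ∃[ a ] ∃[ b ] a ≉ 0# × b ≉ 0# × coeff (f *ᴸ g) (i ℤ.+ j) ≈ a + b
  *-two-terms f g {j = j} fᵢ≉0 gⱼ≉0 fᵢ′≉0 gⱼ′≉0 i≢i′ eq with in-window f fᵢ≉0 | in-window f fᵢ′≉0
  ... | k , ≡.refl | k′ , ≡.refl = sum-two-terms (terms f g (window (bound f) k ℤ.+ j)) (λ k≡k′ → i≢i′ (≡.cong (window (bound f)) k≡k′))
    (term≉0 f g fᵢ≉0 gⱼ≉0 ≡.refl) (term≉0 f g fᵢ′≉0 gⱼ′≉0 (≡.sym eq))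

  -- The last hypothesis covers a `k` outside the window: there the sum vanishes, and so must `t k`.
  window-sum-one-term : ∀ N (t : ℤ → Carrier) k → (∀ i → i ≢ k → t i ≈ 0#) → (N ℕ.< ∣ k ∣ → t k ≈ 0#) →
                        sum (λ i → t (window N i)) ≈ t k
  window-sum-one-term N t k t≈0 out with N ℕ.<? ∣ k ∣
  ... | yes N<k = trans (sum≈0 _ all≈0) (sym (out N<k))
    where
    all≈0 : ∀ i → t (window N i) ≈ 0#
    all≈0 i with window N i ℤ.≟ k
    ... | yes eq = trans (reflexive (≡.cong t eq)) (out N<k)
    ... | no neq = t≈0 _ neq
  ... | no N≮k with window-surjective N k (ℕ.≮⇒≥ N≮k)
  ...   | i , ≡.refl = sum-one-term _ i (λ j j≢i → t≈0 _ (j≢i ∘ window-injective N))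

  *-singleˡ : ∀ f g {k} → (∀ n → n ≢ k → coeff f n ≈ 0#) → ∀ n → coeff (f *ᴸ g) n ≈ coeff f k * coeff g (n ℤ.- k)
  *-singleˡ f g {k} f≈0 n = window-sum-one-term (bound f) (term f g n) k
    (λ i i≢k → trans (*-congʳ (f≈0 i i≢k)) (zeroˡ _))
    (λ out → trans (*-congʳ (vanishes f k out)) (zeroˡ _))

  *-singleʳ : ∀ f g {k} → (∀ n → n ≢ k → coeff g n ≈ 0#) → ∀ n → coeff (f *ᴸ g) n ≈ coeff f (n ℤ.- k) * coeff g k
  *-singleʳ f g {k} g≈0 n = trans
    (window-sum-one-term (bound f) (term f g n) (n ℤ.- k)
      -- The second factor is evaluated at n - i, which equals k only for i = n - k.
      (λ i i≢n-k → trans (*-congˡ (g≈0 _ (λ n-i≡k → i≢n-k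
        (≡.trans (≡.sym (n-[n-k]≡k n i)) (≡.cong (ℤ._-_ n) n-i≡k))))) (zeroʳ _))
      (λ out → trans (*-congʳ (vanishes f _ out)) (zeroˡ _)))
    (*-congˡ (coeff-cong g (n-[n-k]≡k n k)))

  -- Monomials and divisors of 1

  monomial-≡ : ∀ a k → coeff (monomial a k) k ≈ a
  monomial-≡ a k with k ℤ.≟ k
  ... | yes _  = refl
  ... | no k≢k = contradiction ≡.refl k≢k

  monomial-≢ : ∀ a {k} n → n ≢ k → coeff (monomial a k) n ≈ 0#
  monomial-≢ a {k} n n≢k with n ℤ.≟ k
  ... | yes n≡k = contradiction n≡k n≢k
  ... | no _    = refl

  monomial∣1 : ∀ f {k} → (∀ n → n ≢ k → coeff f n ≈ 0#) → Unit (coeff f k) → f ∣ 1ᴸ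
  monomial∣1 f {k} f≈0 (u , ufₖ≈1 , _) = record
    -- f is a monomial a xᵏ, so a⁻¹ x⁻ᵏ inverts it.
    { quotient = monomial u (ℤ.- k)
    ; equality = λ n → trans (*-singleʳ (monomial u (ℤ.- k)) f f≈0 n) (pointwise n)
    }
    where
    pointwise : ∀ n → coeff (monomial u (ℤ.- k)) (n ℤ.- k) * coeff f k ≈ coeff 1ᴸ n
    pointwise n with n ℤ.≟ 0ℤ
    ... | yes ≡.refl = trans (*-congʳ (trans (coeff-cong (monomial u (ℤ.- k)) (ℤ.+-identityˡ (ℤ.- k)))
                                           (monomial-≡ u (ℤ.- k)))) ufₖ≈1
    ... | no n≢0 = trans (*-congʳ (monomial-≢ u _ λ eq → n≢0 (+-cancelʳ (ℤ.- k) n 0ℤ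
                      (≡.trans eq (≡.sym (ℤ.+-identityˡ _)))))) (zeroˡ _)

  1ᴸ≉0 : coeff 1ᴸ 0ℤ ≉ 0#
  1ᴸ≉0 = ≉0-resp (sym (monomial-≡ 1# 0ℤ)) 1≉0

  -- If q f = 1 and i is an exponent of q, then i + j is an exponent of 1 for every exponent j of f,
  -- hence i + j = 0.
  ∣1⇒supp-subsingleton : ∀ {f m n} → f ∣ 1ᴸ → coeff f m ≉ 0# → coeff f n ≉ 0# → m ≡ n
  ∣1⇒supp-subsingleton {f} {m} {n} record { quotient = q ; equality = qf≈1 } fₘ≉0 fₙ≉0
    with *-supp⁻ q f {0ℤ} (≉0-resp (sym (qf≈1 0ℤ)) 1ᴸ≉0)
  ... | i , _ , qᵢ≉0 , _ , _ = +-cancelˡ i m n (≡.trans (only-0 fₘ≉0) (≡.sym (only-0 fₙ≉0)))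
    where
    only-0 : ∀ {j} → coeff f j ≉ 0# → i ℤ.+ j ≡ 0ℤ
    only-0 {j} fⱼ≉0 with i ℤ.+ j ℤ.≟ 0ℤ
    ... | yes eq = eq
    ... | no neq = contradiction (trans (qf≈1 (i ℤ.+ j)) (monomial-≢ 1# _ neq)) (*-supp⁺ q f qᵢ≉0 fⱼ≉0)

  monomial-sum₂ : ∀ f {k₀ k₁} → k₀ ≢ k₁ → (∀ n → n ≢ k₀ → n ≢ k₁ → coeff f n ≈ 0#) →
                  f ≈ᴸ monomial (coeff f k₀) k₀ +ᴸ monomial (coeff f k₁) k₁
  monomial-sum₂ f {k₀} {k₁} k₀≢k₁ f≈0 n with n ℤ.≟ k₀ | n ℤ.≟ k₁
  ... | yes ≡.refl | yes ≡.refl = contradiction ≡.refl k₀≢k₁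
  ... | yes ≡.refl | no _       = sym (+-identityʳ _)
  ... | no _       | yes ≡.refl = sym (+-identityˡ _)
  ... | no n≢k₀    | no n≢k₁    = trans (f≈0 n n≢k₀ n≢k₁) (sym (+-identityˡ 0#))

  monomial-sum₃ : ∀ f {k₀ k₁ k₂} → k₀ ≢ k₁ → k₀ ≢ k₂ → k₁ ≢ k₂ →
                  (∀ n → n ≢ k₀ → n ≢ k₁ → n ≢ k₂ → coeff f n ≈ 0#) →
                  f ≈ᴸ monomial (coeff f k₀) k₀ +ᴸ monomial (coeff f k₁) k₁ +ᴸ monomial (coeff f k₂) k₂
  monomial-sum₃ f {k₀} {k₁} {k₂} k₀≢k₁ k₀≢k₂ k₁≢k₂ f≈0 n with n ℤ.≟ k₀ | n ℤ.≟ k₁ | n ℤ.≟ k₂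
  ... | yes ≡.refl | yes k₀≡k₁ | _         = contradiction k₀≡k₁ k₀≢k₁
  ... | yes ≡.refl | _         | yes k₀≡k₂ = contradiction k₀≡k₂ k₀≢k₂
  ... | _         | yes ≡.refl | yes k₁≡k₂ = contradiction k₁≡k₂ k₁≢k₂
  ... | yes ≡.refl | no _      | no _      = sym (trans (+-identityʳ _) (+-identityʳ _))
  ... | no _      | yes ≡.refl | no _      = sym (trans (+-identityʳ _) (+-identityˡ _))
  ... | no _      | no _      | yes ≡.refl = sym (trans (+-congʳ (+-identityˡ 0#)) (+-identityˡ _))
  ... | no n≢k₀   | no n≢k₁   | no n≢k₂   =
    trans (f≈0 n n≢k₀ n≢k₁ n≢k₂) (sym (trans (+-congʳ (+-identityˡ 0#)) (+-identityˡ 0#)))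

  -- Boundedly many summands force indecomposable elements to be units

  sum-isolate : ∀ {n} (v : Vector Carrier n) i → ∃[ r ] sum v ≈ v i + r
  sum-isolate {suc n} v i = sum (removeAt v i) , sum-remove v

  private +ᴸ-rawMonoid = RawSemiring.+-rawMonoid (LaurentPolynomial.rawSemiring A)
  open import Algebra.Definitions.RawMonoid +ᴸ-rawMonoid using () renaming (sum to sumᴸ)

  coeff-sumᴸ : ∀ {k} (v : Vector Laurent k) n → coeff (sumᴸ v) n ≈ sum (λ i → coeff (v i) n)
  coeff-sumᴸ {zero}  v n = refl
  coeff-sumᴸ {suc k} v n = +-congˡ (coeff-sumᴸ (v ∘ suc) n)

  SumsOfAtMostL : ℕ → Set (c ⊔ ℓ)
  SumsOfAtMostL k = ∀ f → HasMoreThan 1 (supp f) → IsSumOfAtMost +ᴸ-rawMonoid IrreducibleL k f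

  -- The coefficients of a (x⁻ᵏ + ⋯ + xᵏ). The range is symmetric so that `k` itself is the bound;
  -- the exponents 0, ..., k already outnumber k summands.
  blockCoeff : Carrier → ℕ → ℤ → Carrier
  blockCoeff a k n with ∣ n ∣ ℕ.≤? k
  ... | yes _ = a
  ... | no  _ = 0#

  blockCoeff-≤ : ∀ a k n → ∣ n ∣ ℕ.≤ k → blockCoeff a k n ≈ a
  blockCoeff-≤ a k n n≤k with ∣ n ∣ ℕ.≤? k
  ... | yes _  = refl
  ... | no n≰k = contradiction n≤k n≰k

  blockCoeff-> : ∀ a k n → k ℕ.< ∣ n ∣ → blockCoeff a k n ≈ 0#
  blockCoeff-> a k n k<n with ∣ n ∣ ℕ.≤? k
  ... | yes n≤k = contradiction n≤k (ℕ.<⇒≱ k<n)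
  ... | no _    = refl

  block : Carrier → ℕ → Laurent
  block a k = record { coeff = blockCoeff a k ; bound = k ; vanishes = blockCoeff-> a k }

  -- By `conical`, the nonzero elements with this property are the additive atoms. Zero has it too
  -- and is excluded separately.
  Indecomposable : Pred Carrier (c ⊔ ℓ)
  Indecomposable a = ∀ b c → a ≈ b + c → b ≈ 0# ⊎ c ≈ 0#

  -- One of at most k summands of a (x⁻ᵏ + ⋯ + xᵏ) has two exponents in common with 1 + x + ⋯ + xᵏ;
  -- as all its coefficients are 0 or a, it is a times a non-unit.
  indecomposable⇒unit : ∀ {k} → 0 < k → SumsOfAtMostL k → ∀ {a} → a ≉ 0# → Indecomposable a → Unit a
  indecomposable⇒unit {k} 0<k sums {a} a≉0 indec
    with n , n≤k , v , irreducible , f≈Σv ← sums (block a k)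
           ( (λ i → + toℕ i)
           , (λ eq → Fin.toℕ-injective (ℤ.+-injective eq))
           -- 0 and 1 are exponents of the block because 0 < k.
           , (λ i → ≉0-resp (sym (blockCoeff-≤ a k (+ toℕ i) (ℕ.≤-trans (ℕ.s≤s⁻¹ (Fin.toℕ<n i)) 0<k))) a≉0))
    = conclude
    where
    coeff≈ : ∀ m → coeff (block a k) m ≈ sum (λ j → coeff (v j) m)
    coeff≈ m = trans (f≈Σv m) (coeff-sumᴸ v m)

    summand : (i : Fin (suc k)) → ∃[ j ] coeff (v j) (+ toℕ i) ≉ 0#
    summand i = sum≉0⇒term≉0 (λ j → coeff (v j) (+ toℕ i)) (≉0-resp
      (trans (sym (blockCoeff-≤ a k (+ toℕ i) (ℕ.s≤s⁻¹ (Fin.toℕ<n i)))) (coeff≈ (+ toℕ i))) a≉0)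

    -- The quotient e is 0 or 1: a nonzero coefficient of one summand uses up the indecomposable a,
    -- leaving nothing to the others. The last component lets the quotient inherit the bound of
    -- `v j`.
    quotient-at : ∀ j m → ∃[ e ] coeff (v j) m ≈ a * e × (coeff (v j) m ≈ 0# → e ≈ 0#)
    quotient-at j m with coeff (v j) m ≈0? | ∣ m ∣ ℕ.≤? k
    ... | yes ≈0 | _ = 0# , trans ≈0 (sym (zeroʳ a)) , λ _ → refl
    ... | no ≉0  | no m≰k = contradiction
      (trans (sym (coeff≈ m)) (blockCoeff-> a k m (ℕ.≰⇒> m≰k)))
      (term≉0⇒sum≉0 (λ j → coeff (v j) m) j ≉0)
    ... | no ≉0  | yes m≤k with sum-isolate (λ j → coeff (v j) m) j
    ...   | r , Σ≈ with trans (sym (blockCoeff-≤ a k m m≤k)) (trans (coeff≈ m) Σ≈)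
    ...     | a≈vⱼ+r with indec _ r a≈vⱼ+r
    ...       | inj₁ ≈0  = contradiction ≈0 ≉0
    ...       | inj₂ r≈0 = 1# ,
      sym (trans (*-identityʳ a) (trans a≈vⱼ+r (trans (+-congˡ r≈0) (+-identityʳ _)))) ,
      λ ≈0 → contradiction ≈0 ≉0

    quotient : Fin n → Laurent
    quotient j = record
      { coeff = λ m → proj₁ (quotient-at j m)
      ; bound = bound (v j)
      ; vanishes = λ m out → proj₂ (proj₂ (quotient-at j m)) (vanishes (v j) m out)
      }

    factorisation : ∀ j → v j ≈ᴸ monomial a 0ℤ *ᴸ quotient j
    factorisation j m = trans (proj₁ (proj₂ (quotient-at j m))) (sym (trans
      (*-singleˡ (monomial a 0ℤ) (quotient j) (monomial-≢ a) m)
      (*-cong (monomial-≡ a 0ℤ) (coeff-cong (quotient j) (ℤ.+-identityʳ m)))))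

    quotient≉0 : ∀ {j m} → coeff (v j) m ≉ 0# → coeff (quotient j) m ≉ 0#
    quotient≉0 {j} {m} ≉0 = *-≉0ʳ (≉0-resp (proj₁ (proj₂ (quotient-at j m))) ≉0)

    constant∣1⇒unit : monomial a 0ℤ ∣ 1ᴸ → Unit a
    constant∣1⇒unit record { quotient = q ; equality = qa≈1 } =
      coeff q 0ℤ , eq , trans (*-comm _ _) eq
      where
      eq : coeff q 0ℤ * a ≈ 1#
      eq = trans (*-congˡ (sym (monomial-≡ a 0ℤ)))
        (trans (sym (*-singleʳ q (monomial a 0ℤ) (monomial-≢ a) 0ℤ)) (trans (qa≈1 0ℤ) (monomial-≡ 1# 0ℤ)))

    conclude : Unit a
    conclude with Fin.pigeonhole (s≤s n≤k) (proj₁ ∘ summand)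
    -- There are k + 1 exponents 0, ..., k and at most k summands, so one summand contains two of
    -- them.
    ... | i , i′ , i<i′ , same with Irreducible.split-∣1 (proj₂ (irreducible (proj₁ (summand i))))
                                   {monomial a 0ℤ} {quotient (proj₁ (summand i))}
                                   (factorisation (proj₁ (summand i)))
    ...   | inj₁ a∣1 = constant∣1⇒unit a∣1
    ...   | inj₂ q∣1 = contradiction (ℤ.+-injective (∣1⇒supp-subsingleton {quotient (proj₁ (summand i))} q∣1
      (quotient≉0 (proj₂ (summand i)))
      (quotient≉0 (≡.subst (λ j → coeff (v j) (+ toℕ i′) ≉ 0#) (≡.sym same) (proj₂ (summand i′))))))
      (ℕ.<⇒≢ i<i′)

  -- Extreme exponents of a support

  module _ (O : TranslationOrder) where
    open TranslationOrder O

    greatest : ∀ f {q} {P : Pred ℤ q} (P? : ∀ i → Dec (P i)) → (∀ {n} → P n → coeff f n ≉ 0#) → ∃ P →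
               ∃[ M ] P M × (∀ n → P n → n ≼ M)
    greatest f {P = P} P? P⊆supp (n₀ , Pn₀) with in-window f (P⊆supp Pn₀)
    ... | i₀ , ≡.refl with greatest-in-range O P? (window (bound f)) (i₀ , Pn₀)
    ...   | M , PM , max = M , PM , max′
      where
      max′ : ∀ n → P n → n ≼ M
      max′ n Pn with in-window f (P⊆supp Pn)
      ... | i , ≡.refl = max i Pn

  module _ (O : TranslationOrder) where
    open TranslationOrder O

    supp-range : ∀ f {n} → coeff f n ≉ 0# →
      ∃[ m ] ∃[ M ] coeff f m ≉ 0# × coeff f M ≉ 0# × (∀ n → coeff f n ≉ 0# → m ≼ n × n ≼ M)
    supp-range f {n} fₙ≉0 =
      -- The least exponent is the greatest one for the reversed order.
      let m , fₘ≉0 , min = greatest (reverse O) f (λ n → dec (coeff f n ≉ 0#)) id (n , fₙ≉0)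
          M , f_M≉0 , max = greatest O f (λ n → dec (coeff f n ≉ 0#)) id (n , fₙ≉0)
      in m , M , fₘ≉0 , f_M≉0 , λ n fₙ≉0 → [ inj₁ , inj₂ ∘ ≡.sym ]′ (min n fₙ≉0) , max n fₙ≉0

  -- Sums of two irreducibles

  -- The two parameters are what equality of atoms and units provides: a unit is no sum of two
  -- nonzero elements, and a nonzero nonunit can be shared between two summands, one of which
  -- receives a unit.
  module Goldbach
    (unit-indecomposable : ∀ {a b c} → Unit a → a ≈ b + c → b ≈ 0# ⊎ c ≈ 0#)
    (split-unit : ∀ {a} → a ≉ 0# → ¬ Unit a → ∃[ u ] ∃[ b ] Unit u × b ≉ 0# × a ≈ u + b)
    where

    Decomposable : Pred Laurent (c ⊔ ℓ)
    Decomposable f = ∃[ g ] ∃[ h ] IrreducibleL g × IrreducibleL h × f ≈ᴸ g +ᴸ h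

    -- A criterion for irreducibility

    module Irreducibility (O : TranslationOrder) where
      open TranslationOrder O

      -- The coefficient of a monomial factor divides the unit at w, so that factor is invertible.
      -- Two factors that are not monomials give inner exponents p and q with p + q = m + M; by
      -- hypothesis they coincide at a unit coefficient, yet that coefficient has two nonzero terms.
      irreducible-if-no-symmetric-pair : ∀ h {m M w} → m ≺ M →
        coeff h m ≉ 0# → coeff h M ≉ 0# → Unit (coeff h w) →
        (∀ n → coeff h n ≉ 0# → m ≼ n × n ≼ M) →
        (∀ p q → coeff h p ≉ 0# → coeff h q ≉ 0# → p ≢ m → p ≢ M → q ≢ m → q ≢ M →
          p ℤ.+ q ≡ m ℤ.+ M → p ≡ q × Unit (coeff h p)) →
        IrreducibleL h
      irreducible-if-no-symmetric-pair h {m} {M} {w} m≺M hₘ≉0 h_M≉0 U range symmetric =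
        (λ h≈0 → hₘ≉0 (h≈0 m)) ,
        mkIrred (λ h∣1 → ≺⇒≢ m≺M (∣1⇒supp-subsingleton h∣1 hₘ≉0 h_M≉0)) split
        where
        split : ∀ {x y} → h ≈ᴸ x *ᴸ y → (x ∣ 1ᴸ) ⊎ (y ∣ 1ᴸ)
        split {x} {y} h≈xy
          with i , j , xᵢ≉0 , yⱼ≉0 , i+j≡m ← *-supp⁻ x y (≉0-resp (h≈xy m) hₘ≉0)
             | k , l , xₖ≉0 , yₗ≉0 , k+l≡M ← *-supp⁻ x y (≉0-resp (h≈xy M) h_M≉0)
          with x₋ , x₊ , x₋≉0 , x₊≉0 , x-range ← supp-range O x xᵢ≉0
             | y₋ , y₊ , y₋≉0 , y₊≉0 , y-range ← supp-range O y yⱼ≉0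
          with x₋ ℤ.≟ x₊ | y₋ ℤ.≟ y₊
        ... | yes ≡.refl | _ = inj₁ (monomial∣1 x x≈0
                (unit-factorˡ (unit-resp (trans (h≈xy w) (*-singleˡ x y x≈0 w)) U)))
          where
          x≈0 : ∀ n → n ≢ x₋ → coeff x n ≈ 0#
          x≈0 n n≢ = ¬≉0⇒≈0 λ xₙ≉0 → n≢ (≼-antisym (proj₂ (x-range n xₙ≉0)) (proj₁ (x-range n xₙ≉0)))
        ... | no _ | yes ≡.refl = inj₂ (monomial∣1 y y≈0
                (unit-factorʳ (unit-resp (trans (h≈xy w) (*-singleʳ x y y≈0 w)) U)))
          where
          y≈0 : ∀ n → n ≢ y₋ → coeff y n ≈ 0#
          y≈0 n n≢ = ¬≉0⇒≈0 λ yₙ≉0 → n≢ (≼-antisym (proj₂ (y-range n yₙ≉0)) (proj₁ (y-range n yₙ≉0)))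
        ... | no x₋≢x₊ | no y₋≢y₊ =
          let p≡q , Uₚ = symmetric p q (h≉0 x₋≉0 y₊≉0) (h≉0 x₊≉0 y₋≉0)
                -- p = m = x₋ + y₋ would give y₊ = y₋; the other three cases are alike.
                (λ p≡m → y₋≢y₊ (≡.sym (+-cancelˡ x₋ _ _ (≡.trans p≡m m≡))))
                (λ p≡M → x₋≢x₊ (+-cancelʳ y₊ _ _ (≡.trans p≡M M≡)))
                (λ q≡m → x₋≢x₊ (≡.sym (+-cancelʳ y₋ _ _ (≡.trans q≡m m≡))))
                (λ q≡M → y₋≢y₊ (+-cancelˡ x₊ _ _ (≡.trans q≡M M≡)))
                p+q≡m+M
              a , b , a≉0 , b≉0 , eq = *-two-terms x y x₋≉0 y₊≉0 x₊≉0 y₋≉0 x₋≢x₊ p≡q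
          in ⊥-elim ([ a≉0 , b≉0 ]′ (unit-indecomposable Uₚ (trans (h≈xy p) eq)))
          where
          p q : ℤ
          p = x₋ ℤ.+ y₊
          q = x₊ ℤ.+ y₋

          h≉0 : ∀ {i j} → coeff x i ≉ 0# → coeff y j ≉ 0# → coeff h (i ℤ.+ j) ≉ 0#
          h≉0 xᵢ≉0 yⱼ≉0 = ≉0-resp (sym (h≈xy _)) (*-supp⁺ x y xᵢ≉0 yⱼ≉0)

          -- The sum of the least exponents is an exponent of h, hence at least m, and it is at most
          -- i + j = m.
          m≡ : m ≡ x₋ ℤ.+ y₋
          m≡ = ≼-antisym (proj₁ (range _ (h≉0 x₋≉0 y₋≉0)))
            (≡.subst (x₋ ℤ.+ y₋ ≼_) i+j≡m (+-mono-≼ (proj₁ (x-range i xᵢ≉0)) (proj₁ (y-range j yⱼ≉0))))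

          M≡ : M ≡ x₊ ℤ.+ y₊
          M≡ = ≼-antisym
            (≡.subst (_≼ x₊ ℤ.+ y₊) k+l≡M (+-mono-≼ (proj₂ (x-range k xₖ≉0)) (proj₂ (y-range l yₗ≉0))))
            (proj₂ (range _ (h≉0 x₊≉0 y₊≉0)))

          p+q≡m+M : p ℤ.+ q ≡ m ℤ.+ M
          p+q≡m+M = begin
            (x₋ ℤ.+ y₊) ℤ.+ (x₊ ℤ.+ y₋)   ≡⟨ interchange x₋ y₊ x₊ y₋ ⟩
            (x₋ ℤ.+ x₊) ℤ.+ (y₊ ℤ.+ y₋)   ≡⟨ ≡.cong (ℤ._+_ (x₋ ℤ.+ x₊)) (ℤ.+-comm y₊ y₋) ⟩
            (x₋ ℤ.+ x₊) ℤ.+ (y₋ ℤ.+ y₊)   ≡⟨ interchange x₋ x₊ y₋ y₊ ⟩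
            (x₋ ℤ.+ y₋) ℤ.+ (x₊ ℤ.+ y₊)   ≡⟨ ≡.cong₂ ℤ._+_ m≡ M≡ ⟨
            m ℤ.+ M                       ∎
            where open ≡.≡-Reasoning

      -- b may be the coefficient at n of a polynomial with extreme exponents m, M
      -- and a unit coefficient at w, whose inner exponents lie on one side of (m + M) / 2.
      record Admissible (_◃_ : Rel ℤ 0ℓ) (m M w n : ℤ) (b : Carrier) : Set (c ⊔ ℓ) where
        field
          at-m  : n ≡ m → b ≉ 0#
          at-M  : n ≡ M → b ≉ 0#
          at-w  : n ≡ w → Unit b
          inner : b ≉ 0# → n ≢ m → n ≢ M →
                  m ≺ n × n ≺ M × ¬ (n ℤ.+ n) ◃ (m ℤ.+ M) × (n ℤ.+ n ≡ m ℤ.+ M → Unit b)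

      -- Two inner exponents symmetric about the midpoint lie on the same side of it, so both are
      -- the midpoint, where the coefficient is a unit. `balanced` is this argument for the chosen
      -- side.
      admissible⇒irreducible : ∀ {_◃_ m M w} h →
        (∀ {p q s} → p ℤ.+ q ≡ s → ¬ (p ℤ.+ p) ◃ s → ¬ (q ℤ.+ q) ◃ s → p ≡ q) →
        m ≺ M → (∀ n → Admissible _◃_ m M w n (coeff h n)) → IrreducibleL h
      admissible⇒irreducible {m = m} {M} {w} h balanced m≺M adm =
        irreducible-if-no-symmetric-pair h m≺M (at-m (adm m) ≡.refl) (at-M (adm M) ≡.refl)
          (at-w (adm w) ≡.refl) range symmetric
        where
        open Admissible
        range : ∀ n → coeff h n ≉ 0# → m ≼ n × n ≼ M
        range n hₙ≉0 = inside⇒bounded m≺M λ n≢m n≢M →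
          let m≺n , n≺M , _ = inner (adm n) hₙ≉0 n≢m n≢M in m≺n , n≺M
        symmetric : ∀ p q → coeff h p ≉ 0# → coeff h q ≉ 0# → p ≢ m → p ≢ M → q ≢ m → q ≢ M →
                    p ℤ.+ q ≡ m ℤ.+ M → p ≡ q × Unit (coeff h p)
        symmetric p q hₚ≉0 h_q≉0 p≢m p≢M q≢m q≢M p+q≡s =
          let _ , _ , ¬2p◃s , centre = inner (adm p) hₚ≉0 p≢m p≢M
              _ , _ , ¬2q◃s , _      = inner (adm q) h_q≉0 q≢m q≢M
              p≡q = balanced p+q≡s ¬2p◃s ¬2q◃s
          in p≡q , centre (≡.trans (≡.cong (ℤ._+_ p) p≡q) p+q≡s)

      -- The relation names the forbidden side: `Upper` keeps inner exponents at or above the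
      -- midpoint, `Lower` at or below it.
      Upper Lower : (m M w n : ℤ) → Pred Carrier (c ⊔ ℓ)
      Upper = Admissible _≺_
      Lower = Admissible (flip _≺_)

      -- It suffices to share out each coefficient separately. By `conical` both shares vanish where
      -- f does, so the bound of f serves both summands.
      decompose : ∀ f {m₁ M₁ w₁ m₂ M₂ w₂} → m₁ ≺ M₁ → m₂ ≺ M₂ →
        (∀ n → ∃[ a ] ∃[ b ] coeff f n ≈ a + b × Upper m₁ M₁ w₁ n a × Lower m₂ M₂ w₂ n b) →
        Decomposable f
      decompose f m₁≺M₁ m₂≺M₂ parts =
        g , h ,
        admissible⇒irreducible g p+q≡s⇒p≡q m₁≺M₁ (λ n → let _ , _ , _ , up , _ = parts n in up) ,
        admissible⇒irreducible h (TranslationOrder.p+q≡s⇒p≡q (reverse O)) m₂≺M₂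
          (λ n → let _ , _ , _ , _ , low = parts n in low) ,
        λ n → let _ , _ , eq , _ = parts n in eq
        where
        g h : Laurent
        g = record
          { coeff = λ n → proj₁ (parts n)
          ; bound = bound f
          ; vanishes = λ n out → let a , b , eq , _ = parts n in
              conical a b (trans (sym eq) (vanishes f n out))
          }
        h = record
          { coeff = λ n → proj₁ (proj₂ (parts n))
          ; bound = bound f
          ; vanishes = λ n out → let a , b , eq , _ = parts n in
              conical b a (trans (+-comm b a) (trans (sym eq) (vanishes f n out)))
          }

      absent : ∀ {_◃_ m M w n} → n ≢ m → n ≢ M → n ≢ w → Admissible _◃_ m M w n 0#
      absent n≢m n≢M n≢w = record
        { at-m  = λ n≡m → contradiction n≡m n≢m
        ; at-M  = λ n≡M → contradiction n≡M n≢M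
        ; at-w  = λ n≡w → contradiction n≡w n≢w
        ; inner = λ 0≉0 → contradiction refl 0≉0
        }

      at-left-end : ∀ {_◃_ m M w b} → m ≢ M → b ≉ 0# → (m ≡ w → Unit b) → Admissible _◃_ m M w m b
      at-left-end m≢M b≉0 U = record
        { at-m  = λ _ → b≉0
        ; at-M  = λ m≡M → contradiction m≡M m≢M
        ; at-w  = U
        ; inner = λ _ m≢m → contradiction ≡.refl m≢m
        }

      at-right-end : ∀ {_◃_ m M w b} → m ≢ M → b ≉ 0# → (M ≡ w → Unit b) → Admissible _◃_ m M w M b
      at-right-end m≢M b≉0 U = record
        { at-m  = λ M≡m → contradiction (≡.sym M≡m) m≢M
        ; at-M  = λ _ → b≉0
        ; at-w  = U
        ; inner = λ _ _ M≢M → contradiction ≡.refl M≢M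
        }

      between : ∀ {_◃_ m M w n b} → n ≢ m → n ≢ M → n ≢ w → (b ≉ 0# → m ≺ n × n ≺ M) →
                ¬ (n ℤ.+ n) ◃ (m ℤ.+ M) → (b ≉ 0# → n ℤ.+ n ≡ m ℤ.+ M → Unit b) →
                Admissible _◃_ m M w n b
      between n≢m n≢M n≢w range ¬◃ centre = record
        { at-m  = λ n≡m → contradiction n≡m n≢m
        ; at-M  = λ n≡M → contradiction n≡M n≢M
        ; at-w  = λ n≡w → contradiction n≡w n≢w
        ; inner = λ b≉0 _ _ → let m≺n , n≺M = range b≉0 in m≺n , n≺M , ¬◃ , centre b≉0
        }

      -- Cutting a polynomial in two according to its extreme coefficients

      record Extremes (f : Laurent) (m M : ℤ) : Set ℓ where
        field
          m≺M   : m ≺ M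
          m∈    : coeff f m ≉ 0#
          M∈    : coeff f M ≉ 0#
          range : ∀ {n} → coeff f n ≉ 0# → n ≢ m → n ≢ M → m ≺ n × n ≺ M

      extremes-bound : ∀ {f m M} → Extremes f m M → ∀ n → coeff f n ≉ 0# → m ≼ n × n ≼ M
      extremes-bound E n fₙ≉0 = inside⇒bounded m≺M (range fₙ≉0)
        where open Extremes E

      extremes : ∀ f → HasMoreThan 1 (supp f) → ∃[ m ] ∃[ M ] Extremes f m M
      extremes f (v , v-injective , v∈)
        with m , M , m∈ , M∈ , bounds ← supp-range O f (v∈ zero) = m , M , record
          { m≺M   = ≼∧≢⇒≺ (proj₁ (bounds M M∈)) m≢M
          ; m∈    = m∈
          ; M∈    = M∈
          ; range = λ fₙ≉0 n≢m n≢M → let m≼n , n≼M = bounds _ fₙ≉0 in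
              ≼∧≢⇒≺ m≼n (n≢m ∘ ≡.sym) , ≼∧≢⇒≺ n≼M n≢M
          }
          where
          m≢M : m ≢ M
          m≢M ≡.refl = contradiction (v-injective {zero} {suc zero} (≡.trans (all≡m zero) (≡.sym (all≡m (suc zero))))) λ ()
            where
            all≡m : ∀ i → v i ≡ m
            all≡m i = let m≼vᵢ , vᵢ≼m = bounds (v i) (v∈ i) in ≼-antisym vᵢ≼m m≼vᵢ

      -- Both summands contain m and M, sharing their coefficients; the inner exponents
      -- n ≥ (m + M) / 2 go to the first summand, the others to the second.
      nonunit-ends⇒decomposable : ∀ f {m M} → Extremes f m M →
        ¬ Unit (coeff f m) → ¬ Unit (coeff f M) →
        (∀ {n} → coeff f n ≉ 0# → n ≢ m → n ≢ M → n ℤ.+ n ≡ m ℤ.+ M → Unit (coeff f n)) →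
        Decomposable f
      nonunit-ends⇒decomposable f {m} {M} E ¬Uₘ ¬U_M centre
        with u , a , Uᵤ , a≉0 , fₘ≈u+a ← split-unit (Extremes.m∈ E) ¬Uₘ
           | v , b , Uᵥ , b≉0 , f_M≈v+b ← split-unit (Extremes.M∈ E) ¬U_M = decompose f m≺M m≺M parts
        where
        open Extremes E
        m≢M : m ≢ M
        m≢M = ≺⇒≢ m≺M
        -- The unit shares are placed crosswise: the first summand has the unit v at M, the second
        -- the unit u at m.
        parts : ∀ n → ∃[ x ] ∃[ y ] coeff f n ≈ x + y × Upper m M M n x × Lower m M m n y
        parts n with n ℤ.≟ m | n ℤ.≟ M
        ... | yes ≡.refl | _ = a , u , trans fₘ≈u+a (+-comm u a) ,
          at-left-end m≢M a≉0 (λ m≡M → contradiction m≡M m≢M) ,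
          at-left-end m≢M (unit≉0 Uᵤ) (λ _ → Uᵤ)
        ... | no _ | yes ≡.refl = v , b , f_M≈v+b ,
          at-right-end m≢M (unit≉0 Uᵥ) (λ _ → Uᵥ) ,
          at-right-end m≢M b≉0 (λ M≡m → contradiction (≡.sym M≡m) m≢M)
        ... | no n≢m | no n≢M with ≼-total (m ℤ.+ M) (n ℤ.+ n)
        -- The exponent (m + M) / 2 falls on this side, where `centre` makes its coefficient a unit.
        ...   | inj₁ s≼2n = coeff f n , 0# , sym (+-identityʳ _) ,
          between n≢m n≢M n≢M (λ f≉0 → range f≉0 n≢m n≢M) (≼⇒⊁ s≼2n) (λ f≉0 → centre f≉0 n≢m n≢M) ,
          absent n≢m n≢M n≢m
        ...   | inj₂ 2n≺s = 0# , coeff f n , sym (+-identityˡ _) ,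
          absent n≢m n≢M n≢M ,
          between n≢m n≢M n≢m (λ f≉0 → range f≉0 n≢m n≢M) (≼⇒⊁ (inj₁ 2n≺s))
            (λ _ 2n≡s → contradiction 2n≡s (≺⇒≢ 2n≺s))

      -- d is the greatest inner exponent. The summands have extremes m, d and m, M, sharing the
      -- coefficient at m, and the inner exponents n < (m + M) / 2 go to the second summand; when
      -- that one has no unit at M, it receives a unit part of the coefficient at w = (m + M) / 2.
      nonunit-end⇒decomposable : ∀ f {m M d w} → Extremes f m M → ¬ Unit (coeff f m) →
        m ≺ d → d ≺ M → coeff f d ≉ 0# → (∀ {n} → coeff f n ≉ 0# → n ≢ m → n ≢ M → n ≼ d) →
        (w ≡ M × Unit (coeff f M)) ⊎
        (m ≺ w × w ≺ M × w ℤ.+ w ≡ m ℤ.+ M × coeff f w ≉ 0# × ¬ Unit (coeff f w)) →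
        Decomposable f
      nonunit-end⇒decomposable f {m} {M} {d} {w} E ¬Uₘ m≺d d≺M d∈ max unit-at-w
        with u , a , Uᵤ , a≉0 , fₘ≈u+a ← split-unit (Extremes.m∈ E) ¬Uₘ = decompose f m≺d m≺M parts
        where
        open Extremes E
        m≢d = ≺⇒≢ m≺d
        m≢M = ≺⇒≢ m≺M
        M≢m = m≢M ∘ ≡.sym
        M≢d = ≺⇒≢ d≺M ∘ ≡.sym

        m≢w : m ≢ w
        m≢w m≡w = [ (λ (w≡M , _) → m≢M (≡.trans m≡w w≡M)) , (λ (m≺w , _) → ≺⇒≢ m≺w m≡w) ]′ unit-at-w

        M≡w⇒unit : M ≡ w → Unit (coeff f M)
        M≡w⇒unit M≡w = [ proj₂ , (λ (_ , w≺M , _) → contradiction (≡.sym M≡w) (≺⇒≢ w≺M)) ]′ unit-at-w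

        -- The midpoint of the first summand lies strictly below (m + M) / 2, so no inner exponent
        -- passed to that summand sits at its midpoint.
        m+d≺m+M : m ℤ.+ d ≺ m ℤ.+ M
        m+d≺m+M = +-monoʳ-≺ m d≺M

        parts : ∀ n → ∃[ x ] ∃[ y ] coeff f n ≈ x + y × Upper m d m n x × Lower m M w n y
        parts n with n ℤ.≟ m | n ℤ.≟ M
        ... | yes ≡.refl | _ = u , a , fₘ≈u+a ,
          at-left-end m≢d (unit≉0 Uᵤ) (λ _ → Uᵤ) ,
          at-left-end m≢M a≉0 (λ m≡w → contradiction m≡w m≢w)
        ... | no _ | yes ≡.refl = 0# , coeff f M , sym (+-identityˡ _) ,
          absent M≢m M≢d M≢m ,
          at-right-end m≢M M∈ M≡w⇒unit
        ... | no n≢m | no n≢M with n ℤ.≟ w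
        ...   | yes ≡.refl = [ (λ (w≡M , _) → contradiction w≡M n≢M) , halves ]′ unit-at-w
          where
          halves : m ≺ n × n ≺ M × n ℤ.+ n ≡ m ℤ.+ M × coeff f n ≉ 0# × ¬ Unit (coeff f n) →
                   ∃[ x ] ∃[ y ] coeff f n ≈ x + y × Upper m d m n x × Lower m M n n y
          halves (m≺n , n≺M , 2n≡s , n∈ , ¬Uₙ) with v , b , Uᵥ , b≉0 , fₙ≈v+b ← split-unit n∈ ¬Uₙ =
            -- The second summand receives v, a unit at its midpoint. The remainder b goes to the
            -- first, where n is above the midpoint or is the right end d.
            b , v , trans fₙ≈v+b (+-comm v b) ,
            record
              { at-m  = λ n≡m → contradiction n≡m n≢m
              ; at-M  = λ _ → b≉0
              ; at-w  = λ n≡m → contradiction n≡m n≢m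
              ; inner = λ _ _ n≢d → m≺n , ≼∧≢⇒≺ (max n∈ n≢m n≢M) n≢d ,
                  ≼⇒⊁ (inj₁ m+d≺2n) , λ 2n≡m+d → contradiction (≡.sym 2n≡m+d) (≺⇒≢ m+d≺2n)
              } ,
            record
              { at-m  = λ n≡m → contradiction n≡m n≢m
              ; at-M  = λ n≡M → contradiction n≡M n≢M
              ; at-w  = λ _ → Uᵥ
              ; inner = λ _ _ _ → m≺n , n≺M , ≼⇒⊁ (inj₂ 2n≡s) , λ _ → Uᵥ
              }
            where
            m+d≺2n : m ℤ.+ d ≺ n ℤ.+ n
            m+d≺2n = ≺-≼-trans m+d≺m+M (inj₂ (≡.sym 2n≡s))
        ...   | no n≢w with n ℤ.≟ d
        -- As the right end of the first summand, d goes there on whichever side of (m + M) / 2 it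
        -- lies.
        ...     | yes ≡.refl = coeff f n , 0# , sym (+-identityʳ _) ,
          at-right-end m≢d d∈ (λ d≡m → contradiction (≡.sym d≡m) m≢d) ,
          absent n≢m n≢M n≢w
        ...     | no n≢d with ≼-total (m ℤ.+ M) (n ℤ.+ n)
        ...       | inj₁ s≼2n = coeff f n , 0# , sym (+-identityʳ _) ,
          between n≢m n≢d n≢m
            (λ f≉0 → proj₁ (range f≉0 n≢m n≢M) , ≼∧≢⇒≺ (max f≉0 n≢m n≢M) n≢d)
            (≼⇒⊁ (inj₁ m+d≺2n)) (λ _ 2n≡m+d → contradiction (≡.sym 2n≡m+d) (≺⇒≢ m+d≺2n)) ,
          absent n≢m n≢M n≢w
          where
          m+d≺2n : m ℤ.+ d ≺ n ℤ.+ n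
          m+d≺2n = ≺-≼-trans m+d≺m+M s≼2n
        ...       | inj₂ 2n≺s = 0# , coeff f n , sym (+-identityˡ _) ,
          absent n≢m n≢d n≢m ,
          between n≢m n≢M n≢w (λ f≉0 → range f≉0 n≢m n≢M) (≼⇒⊁ (inj₁ 2n≺s))
            (λ _ 2n≡s → contradiction 2n≡s (≺⇒≢ 2n≺s))

      -- e and d are the least and greatest inner exponents. The summands have extremes m, d and e, M,
      -- and the other exponents are separated by (e + M) / 2, which exceeds (m + d) / 2.
      unit-ends⇒decomposable : ∀ f {m M e d} → Extremes f m M → Unit (coeff f m) → Unit (coeff f M) →
        m ≺ e → d ≺ M → coeff f e ≉ 0# → coeff f d ≉ 0# →
        (∀ {n} → coeff f n ≉ 0# → n ≢ m → n ≢ M → e ≼ n × n ≼ d) →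
        e ≺ d ⊎ (e ≡ d × ¬ Unit (coeff f e)) →
        Decomposable f
      unit-ends⇒decomposable f {m} {M} {e} {d} E Uₘ U_M m≺e d≺M e∈ d∈ inner-range e≺d⊎split =
        decompose f m≺d e≺M parts
        where
        open Extremes E
        e≼d : e ≼ d
        e≼d = [ inj₁ , inj₂ ∘ proj₁ ]′ e≺d⊎split
        m≺d = ≺-≼-trans m≺e e≼d
        e≺M = ≼-≺-trans e≼d d≺M
        m≢d = ≺⇒≢ m≺d
        e≢M = ≺⇒≢ e≺M
        m≢M = ≺⇒≢ m≺M
        M≢m = m≢M ∘ ≡.sym
        M≢d = ≺⇒≢ d≺M ∘ ≡.sym

        m+d≺e+M : m ℤ.+ d ≺ e ℤ.+ M
        m+d≺e+M = ≺-trans (+-monoˡ-≺ d m≺e) (+-monoʳ-≺ e d≺M)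

        parts : ∀ n → ∃[ x ] ∃[ y ] coeff f n ≈ x + y × Upper m d m n x × Lower e M M n y
        parts n with n ℤ.≟ m | n ℤ.≟ M
        ... | yes ≡.refl | _ = coeff f m , 0# , sym (+-identityʳ _) ,
          at-left-end m≢d m∈ (λ _ → Uₘ) ,
          absent (≺⇒≢ m≺e) m≢M m≢M
        ... | no _ | yes ≡.refl = 0# , coeff f M , sym (+-identityˡ _) ,
          absent M≢m M≢d M≢m ,
          at-right-end e≢M M∈ (λ _ → U_M)
        ... | no n≢m | no n≢M with n ℤ.≟ d | n ℤ.≟ e
        ...   | yes ≡.refl | no d≢e = coeff f d , 0# , sym (+-identityʳ _) ,
          at-right-end m≢d d∈ (λ d≡m → contradiction (≡.sym d≡m) m≢d) ,
          absent d≢e n≢M n≢M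
        ...   | no e≢d | yes ≡.refl = 0# , coeff f e , sym (+-identityˡ _) ,
          absent n≢m e≢d n≢m ,
          at-left-end e≢M e∈ (λ e≡M → contradiction e≡M e≢M)
        -- A single inner exponent is the right end of one summand and the left end of the other, so
        -- its coefficient is shared, which is possible because it is not a unit.
        ...   | yes ≡.refl | yes ≡.refl = [ (λ n≺n → contradiction n≺n ≺-irrefl) , halves ∘ proj₂ ]′ e≺d⊎split
          where
          halves : ¬ Unit (coeff f n) →
                   ∃[ x ] ∃[ y ] coeff f n ≈ x + y × Upper m n m n x × Lower n M M n y
          halves ¬Uₙ with u , b , Uᵤ , b≉0 , fₙ≈u+b ← split-unit e∈ ¬Uₙ =
            u , b , fₙ≈u+b ,
            at-right-end m≢d (unit≉0 Uᵤ) (λ _ → Uᵤ) ,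
            at-left-end e≢M b≉0 (λ e≡M → contradiction e≡M e≢M)
        ...   | no n≢d | no n≢e with ≼-total (e ℤ.+ M) (n ℤ.+ n)
        ...     | inj₁ s≼2n = coeff f n , 0# , sym (+-identityʳ _) ,
          between n≢m n≢d n≢m
            (λ f≉0 → proj₁ (range f≉0 n≢m n≢M) , ≼∧≢⇒≺ (proj₂ (inner-range f≉0 n≢m n≢M)) n≢d)
            (≼⇒⊁ (inj₁ m+d≺2n)) (λ _ 2n≡m+d → contradiction (≡.sym 2n≡m+d) (≺⇒≢ m+d≺2n)) ,
          absent n≢e n≢M n≢M
          where
          m+d≺2n : m ℤ.+ d ≺ n ℤ.+ n
          m+d≺2n = ≺-≼-trans m+d≺e+M s≼2n
        ...     | inj₂ 2n≺s = 0# , coeff f n , sym (+-identityˡ _) ,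
          absent n≢m n≢d n≢m ,
          between n≢e n≢M n≢M
            (λ f≉0 → ≼∧≢⇒≺ (proj₁ (inner-range f≉0 n≢m n≢M)) (n≢e ∘ ≡.sym) , proj₂ (range f≉0 n≢m n≢M))
            (≼⇒⊁ (inj₁ 2n≺s)) (λ _ 2n≡s → contradiction 2n≡s (≺⇒≢ 2n≺s))

  -- Atoms and units

  module AdditivelyAtomicDomain (atomic : AdditivelyAtomic (CommutativeSemiring.rawSemiring A)) where

    Atom : Pred Carrier (c ⊔ ℓ)
    Atom = 𝒜₊ (CommutativeSemiring.rawSemiring A)

    invertible⇒≈0 : ∀ a → IsInvertible +-rawMonoid a → a ≈ 0#
    invertible⇒≈0 a (b , _ , a+b≈0) = conical a b a+b≈0

    ≈0⇒invertible : ∀ {a} → a ≈ 0# → IsInvertible +-rawMonoid a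
    ≈0⇒invertible a≈0 = 0# , trans (+-identityˡ _) a≈0 , trans (+-identityʳ _) a≈0

    atom≉0 : ∀ {a} → Atom a → a ≉ 0#
    atom≉0 (¬inv , _) = ¬inv ∘ ≈0⇒invertible

    atom⇒indecomposable : ∀ {a} → Atom a → Indecomposable a
    atom⇒indecomposable (_ , atom) b c a≈b+c = [ inj₁ ∘ invertible⇒≈0 b , inj₂ ∘ invertible⇒≈0 c ]′ (atom b c a≈b+c)

    first-atom : ∀ a → a ≉ 0# → ∃[ u ] ∃[ b ] Atom u × a ≈ u + b
    first-atom a a≉0 with atomic a (a≉0 ∘ invertible⇒≈0 a)
    ... | zero  , _ , _ , a≈0    = contradiction a≈0 a≉0
    ... | suc n , v , atoms , a≈ = v zero , _ , atoms zero , a≈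

    unit-indecomposable⇒atom : ∀ {a} → Unit a → Indecomposable a → Atom a
    unit-indecomposable⇒atom {a} U indec = (λ inv → unit≉0 U (invertible⇒≈0 a inv)) ,
      λ b c a≈b+c → [ inj₁ ∘ ≈0⇒invertible , inj₂ ∘ ≈0⇒invertible ]′ (indec b c a≈b+c)

    -- Multiplying a decomposition of b by t decomposes a, and the absence of zero divisors removes
    -- t again.
    indecomposable-factor : ∀ {a b t} → t ≉ 0# → a ≈ t * b → Indecomposable a → Indecomposable b
    indecomposable-factor {t = t} t≉0 a≈tb indec x y b≈x+y =
      [ inj₁ ∘ cancel , inj₂ ∘ cancel ]′
        (indec (t * x) (t * y) (trans a≈tb (trans (*-congˡ b≈x+y) (distribˡ _ _ _))))
      where
      cancel : ∀ {x} → t * x ≈ 0# → x ≈ 0#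
      cancel tx≈0 = [ (λ t≈0 → contradiction t≈0 t≉0) , id ]′ (noZeroDivisor _ _ tx≈0)

    -- Atoms are units by `indecomposable⇒unit`. Conversely, a decomposition of 1 contains some atom
    -- u, and every unit a divides it: u = (u a⁻¹) a, so a is indecomposable as well.
    boundedSums⇒atoms≐units : ∃[ k ] 0 < k × SumsOfAtMostL k → Atom ≐ Unit
    boundedSums⇒atoms≐units (k , 0<k , sums) = atom⇒unit , unit⇒atom
      where
      atom⇒unit : ∀ {a} → Atom a → Unit a
      atom⇒unit atom = indecomposable⇒unit 0<k sums (atom≉0 atom) (atom⇒indecomposable atom)

      unit⇒atom : ∀ {a} → Unit a → Atom a
      unit⇒atom {a} U@(a⁻¹ , a⁻¹a≈1 , _) with first-atom 1# 1≉0
      ... | u , _ , atom , _ = unit-indecomposable⇒atom U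
        (indecomposable-factor {t = u * a⁻¹} (*-≉0 (atom≉0 atom) a⁻¹≉0)
          (sym (trans (*-assoc _ _ _) (trans (*-congˡ a⁻¹a≈1) (*-identityʳ _))))
          (atom⇒indecomposable atom))
        where
        a⁻¹≉0 : a⁻¹ ≉ 0#
        a⁻¹≉0 = *-≉0ˡ (≉0-resp {b = a⁻¹ * a} (sym a⁻¹a≈1) 1≉0)

    module _ (atoms≐units : Atom ≐ Unit) where

      -- The remainder after the first atom is nonzero, since otherwise a would equal that atom and
      -- be a unit.
      split-unit : ∀ {a} → a ≉ 0# → ¬ Unit a → ∃[ u ] ∃[ b ] Unit u × b ≉ 0# × a ≈ u + b
      split-unit {a} a≉0 ¬U with first-atom a a≉0
      ... | u , b , atom , a≈u+b = u , b , proj₁ atoms≐units atom ,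
        (λ b≈0 → ¬U (unit-resp (sym (trans a≈u+b (trans (+-congˡ b≈0) (+-identityʳ _))))
                              (proj₁ atoms≐units atom))) ,
        a≈u+b

      open Goldbach (λ U → atom⇒indecomposable (proj₂ atoms≐units U) _ _) split-unit
      open Irreducibility usual
      -- The mirrored copy serves when the lower extreme coefficient is a unit and the upper one is
      -- not.
      private module Mirror = Irreducibility (reverse usual)
      open TranslationOrder usual

      Binomial Trinomial : Pred Laurent (c ⊔ ℓ)
      Binomial f = ∃[ k₀ ] ∃[ k₁ ]
        coeff f k₀ ≉ 0# × coeff f k₁ ≉ 0# × (Unit (coeff f k₀) ⊎ Unit (coeff f k₁)) × k₀ ≢ k₁ ×
        f ≈ᴸ monomial (coeff f k₀) k₀ +ᴸ monomial (coeff f k₁) k₁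
      Trinomial f = ∃[ k₀ ] ∃[ k₁ ] ∃[ k₂ ]
        Unit (coeff f k₀) × Unit (coeff f k₁) × Unit (coeff f k₂) × k₀ ≢ k₁ × k₀ ≢ k₂ × k₁ ≢ k₂ ×
        f ≈ᴸ monomial (coeff f k₀) k₀ +ᴸ monomial (coeff f k₁) k₁ +ᴸ monomial (coeff f k₂) k₂

      private
        -- The exceptional polynomials are themselves irreducible, so this alternative gives at most
        -- two summands always, and two outside the forms (a) and (b).
        Result : Pred Laurent (c ⊔ ℓ)
        Result f = Decomposable f ⊎ (IrreducibleL f × (Binomial f ⊎ Trinomial f))

      -- Without inner exponents there is no symmetric pair, so one unit coefficient makes f
      -- irreducible.
      unit-binomial : ∀ f {m M} → Extremes f m M → Unit (coeff f m) ⊎ Unit (coeff f M) →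
                 (∀ n → n ≢ m → n ≢ M → coeff f n ≈ 0#) → Result f
      unit-binomial f {m} {M} E U f≈0 = inj₂
        ( irreducible (proj₂ unit-coefficient)
        , inj₁ (m , M , m∈ , M∈ , U , ≺⇒≢ m≺M , monomial-sum₂ f (≺⇒≢ m≺M) f≈0) )
        where
        open Extremes E
        unit-coefficient : ∃[ w ] Unit (coeff f w)
        unit-coefficient = [ (λ Uₘ → m , Uₘ) , (λ U_M → M , U_M) ]′ U
        irreducible : ∀ {w} → Unit (coeff f w) → IrreducibleL f
        irreducible U = irreducible-if-no-symmetric-pair f m≺M m∈ M∈ U (extremes-bound E)
          (λ p _ fₚ≉0 _ p≢m p≢M _ _ _ → contradiction (f≈0 p p≢m p≢M) fₚ≉0)

      -- The only possible symmetric pair is e with itself, and its coefficient is a unit.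
      unit-trinomial : ∀ f {m e M} → Extremes f m M → e ≢ m → e ≢ M →
                  Unit (coeff f m) → Unit (coeff f e) → Unit (coeff f M) →
                  (∀ {n} → coeff f n ≉ 0# → n ≢ m → n ≢ M → n ≡ e) → Result f
      unit-trinomial f {m} {e} {M} E e≢m e≢M Uₘ Uₑ U_M only-e = inj₂
        ( irreducible-if-no-symmetric-pair f m≺M m∈ M∈ Uₘ (extremes-bound E)
            (λ p q fₚ≉0 f_q≉0 p≢m p≢M q≢m q≢M _ → let p≡e = only-e fₚ≉0 p≢m p≢M in
              ≡.trans p≡e (≡.sym (only-e f_q≉0 q≢m q≢M)) , ≡.subst (Unit ∘ coeff f) (≡.sym p≡e) Uₑ)
        , inj₂ (m , e , M , Uₘ , Uₑ , U_M , e≢m ∘ ≡.sym , ≺⇒≢ m≺M , e≢M ,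
            monomial-sum₃ f (e≢m ∘ ≡.sym) (≺⇒≢ m≺M) e≢M
              (λ n n≢m n≢e n≢M → ¬≉0⇒≈0 (λ fₙ≉0 → n≢e (only-e fₙ≉0 n≢m n≢M)))) )
        where open Extremes E

      Inner : Laurent → ℤ → ℤ → Pred ℤ ℓ
      Inner f m M n = coeff f n ≉ 0# × n ≢ m × n ≢ M

      no-inner : ∀ f {m M} → Extremes f m M → ¬ ∃ (Inner f m M) → Result f
      no-inner f {m} {M} E ¬inner with em {Unit (coeff f m)} | em {Unit (coeff f M)}
      ... | yes Uₘ | _       = unit-binomial f E (inj₁ Uₘ) (λ n n≢m n≢M → ¬≉0⇒≈0 λ fₙ≉0 → ¬inner (n , fₙ≉0 , n≢m , n≢M))
      ... | no _   | yes U_M = unit-binomial f E (inj₂ U_M) (λ n n≢m n≢M → ¬≉0⇒≈0 λ fₙ≉0 → ¬inner (n , fₙ≉0 , n≢m , n≢M))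
      ... | no ¬Uₘ | no ¬U_M = inj₁ (nonunit-ends⇒decomposable f E ¬Uₘ ¬U_M
        (λ fₙ≉0 n≢m n≢M _ → contradiction (_ , fₙ≉0 , n≢m , n≢M) ¬inner))

      with-inner : ∀ f {m M} → Extremes f m M → ∃ (Inner f m M) → Result f
      with-inner f {m} {M} E inner
        with e , (e∈ , e≢m , e≢M) , min ← greatest (reverse usual) f (λ n → dec (Inner f m M n)) proj₁ inner
           | d , (d∈ , d≢m , d≢M) , max ← greatest usual f (λ n → dec (Inner f m M n)) proj₁ inner
        with em {Unit (coeff f m)} | em {Unit (coeff f M)}
      ... | yes Uₘ | yes U_M = both-units
        where
        open Extremes E
        e≼ : ∀ {n} → coeff f n ≉ 0# → n ≢ m → n ≢ M → e ≼ n
        e≼ fₙ≉0 n≢m n≢M = [ inj₁ , inj₂ ∘ ≡.sym ]′ (min _ (fₙ≉0 , n≢m , n≢M))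
        ≼d : ∀ {n} → coeff f n ≉ 0# → n ≢ m → n ≢ M → n ≼ d
        ≼d fₙ≉0 n≢m n≢M = max _ (fₙ≉0 , n≢m , n≢M)

        decomposed : e ≺ d ⊎ (e ≡ d × ¬ Unit (coeff f e)) → Result f
        decomposed h = inj₁ (unit-ends⇒decomposable f E Uₘ U_M (proj₁ (range e∈ e≢m e≢M)) (proj₂ (range d∈ d≢m d≢M))
          e∈ d∈ (λ fₙ≉0 n≢m n≢M → e≼ fₙ≉0 n≢m n≢M , ≼d fₙ≉0 n≢m n≢M) h)

        both-units : Result f
        both-units with e≼ d∈ d≢m d≢M | em {Unit (coeff f e)}
        ... | inj₁ e≺d | _      = decomposed (inj₁ e≺d)
        ... | inj₂ e≡d | no ¬Uₑ = decomposed (inj₂ (e≡d , ¬Uₑ))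
        ... | inj₂ e≡d | yes Uₑ = unit-trinomial f E e≢m e≢M Uₘ Uₑ U_M (λ fₙ≉0 n≢m n≢M →
          ≼-antisym (≡.subst (_ ≼_) (≡.sym e≡d) (≼d fₙ≉0 n≢m n≢M)) (e≼ fₙ≉0 n≢m n≢M))
      ... | no ¬Uₘ | yes U_M = inj₁ (nonunit-end⇒decomposable f E ¬Uₘ
        (proj₁ (range d∈ d≢m d≢M)) (proj₂ (range d∈ d≢m d≢M)) d∈
        (λ fₙ≉0 n≢m n≢M → max _ (fₙ≉0 , n≢m , n≢M)) (inj₁ (≡.refl , U_M)))
        where open Extremes E
      -- In the reversed order M is the lower end and e the greatest inner exponent.
      ... | yes Uₘ | no ¬U_M = inj₁ (Mirror.nonunit-end⇒decomposable f
        (record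
          { m≺M = m≺M ; m∈ = M∈ ; M∈ = m∈
          ; range = λ fₙ≉0 n≢M n≢m → let m≺n , n≺M = range fₙ≉0 n≢m n≢M in n≺M , m≺n
          })
        ¬U_M (proj₂ (range e∈ e≢m e≢M)) (proj₁ (range e∈ e≢m e≢M)) e∈
        (λ fₙ≉0 n≢M n≢m → min _ (fₙ≉0 , n≢m , n≢M)) (inj₁ (≡.refl , Uₘ)))
        where open Extremes E
      -- The midpoint decides: a nonunit coefficient there is split to give the second summand its
      -- unit; otherwise both ends are split.
      ... | no ¬Uₘ | no ¬U_M with em {∃[ t ] Inner f m M t × t ℤ.+ t ≡ m ℤ.+ M × ¬ Unit (coeff f t)}
      ...   | yes (t , (t∈ , t≢m , t≢M) , 2t≡m+M , ¬Uₜ) = inj₁ (nonunit-end⇒decomposable f E ¬Uₘ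
        (proj₁ (range d∈ d≢m d≢M)) (proj₂ (range d∈ d≢m d≢M)) d∈
        (λ fₙ≉0 n≢m n≢M → max _ (fₙ≉0 , n≢m , n≢M))
        (inj₂ (proj₁ (range t∈ t≢m t≢M) , proj₂ (range t∈ t≢m t≢M) , 2t≡m+M , t∈ , ¬Uₜ)))
        where open Extremes E
      ...   | no ¬centre = inj₁ (nonunit-ends⇒decomposable f E ¬Uₘ ¬U_M (λ fₙ≉0 n≢m n≢M 2n≡m+M →
        decidable-stable em (λ ¬Uₙ → ¬centre (_ , (fₙ≉0 , n≢m , n≢M) , 2n≡m+M , ¬Uₙ))))

      classify : ∀ f → HasMoreThan 1 (supp f) → Result f
      classify f f∈ with m , M , E ← extremes f f∈
        with dec (∃ (Inner f m M))
      ... | yes inner = with-inner f E inner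
      ... | no ¬inner = no-inner f E ¬inner

      decomposable⇒sum≤2 : ∀ {f} → Decomposable f → IsSumOfAtMost +ᴸ-rawMonoid IrreducibleL 2 f
      decomposable⇒sum≤2 (g , h , g-irr , h-irr , f≈g+h) =
        2 , ℕ.≤-refl , (λ { zero → g ; (suc _) → h }) , (λ { zero → g-irr ; (suc zero) → h-irr }) ,
        λ n → trans (f≈g+h n) (+-congˡ (sym (+-identityʳ _)))

      sums≤2 : SumsOfAtMostL 2
      sums≤2 f f∈ with classify f f∈
      ... | inj₁ dec         = decomposable⇒sum≤2 {f} dec
      ... | inj₂ (f-irr , _) = 1 , s≤s z≤n , (λ _ → f) , (λ _ → f-irr) , λ n → sym (+-identityʳ _)

      decomposable : ∀ f → HasMoreThan 1 (supp f) → ¬ Binomial f → ¬ Trinomial f → Decomposable f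
      decomposable f f∈ ¬binomial ¬trinomial with classify f f∈
      ... | inj₁ dec                = dec
      ... | inj₂ (_ , exceptional) = ⊥-elim ([ ¬binomial , ¬trinomial ]′ exceptional)

theorem3p6 :
    ∀ {c ℓ p : Level} → ExcludedMiddle (c ⊔ ℓ ⊔ p) →
    (D : Semidomain c ℓ p) →
    let S = Semidomain.rawSemiring D
        open LaurentSemidomain D
        ⟨1⟩ = 𝒜₊ S ≐ Units S
        ⟨2⟩ = SumsOfAtMost 2
        ⟨3⟩ = ∃[ k ] 0 < k × SumsOfAtMost k
    in
    AdditivelyReduced S →
    AdditivelyAtomic S →
    (⟨1⟩ ⇔ ⟨2⟩) × (⟨2⟩ ⇔ ⟨3⟩) ×
    (⟨1⟩ ⊎ ⟨2⟩ ⊎ ⟨3⟩ →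
      ∀ f → HasMoreThan 1 (supp f) →
      ¬ BinomialWithUnit f → ¬ UnitTrinomial f →
      ∃[ g ] ∃[ h ] IrreducibleLaurent g × IrreducibleLaurent h × f ≈ᴸ g +ᴸ h)
theorem3p6 em D reduced atomic =
  -- The cycle ⟨1⟩ ⇒ ⟨2⟩ ⇒ ⟨3⟩ ⇒ ⟨1⟩ yields both equivalences and reduces each hypothesis of (B) to
  -- ⟨1⟩.
  mk⇔ sums≤2 (3⇒1 ∘ 2⇒3) ,
  mk⇔ 2⇒3 (sums≤2 ∘ 3⇒1) ,
  λ hypothesis f f∈ ¬binomial ¬trinomial →
    decomposable ([ id , [ 3⇒1 ∘ 2⇒3 , 3⇒1 ]′ ]′ hypothesis) f f∈
      (λ (k₀ , k₁ , rest) → ¬binomial (coeff f k₀ , coeff f k₁ , k₀ , k₁ , rest))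
      (λ (k₀ , k₁ , k₂ , rest) → ¬trinomial (coeff f k₀ , coeff f k₁ , coeff f k₂ , k₀ , k₁ , k₂ , rest))
  where
  open Semidomain D using (commutativeSemiring; integralDomain)
  module R = IntegralDomain integralDomain
  open LaurentPolynomial commutativeSemiring using (coeff)
  isConicalDomain : IsConicalDomain commutativeSemiring
  isConicalDomain = record
    { 1≉0           = λ 1≈0 → R.0≉1 (R.sym 1≈0)
    ; conical       = λ a b a+b≈0 → reduced a (b , R.trans (R.+-comm (proj₁ b) (proj₁ a)) a+b≈0 , a+b≈0)
    ; noZeroDivisor = λ a b → R.noZeroDivisor (proj₁ a) (proj₁ b)
    }
  open ConicalDomain commutativeSemiring em isConicalDomain
  open AdditivelyAtomicDomain atomic renaming (boundedSums⇒atoms≐units to 3⇒1)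
  2⇒3 : SumsOfAtMostL 2 → ∃[ k ] 0 < k × SumsOfAtMostL k
  2⇒3 sums = 2 , s≤s z≤n , sums
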